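{- The category $\mathsf{MC}^\top$ is equivalent to the full subcategory of $\mathsf{HF}$ whose objects have the form $\{(\mathbf{1},J_i)\}_{i\in I}$. Consequently, $\mathsf{MC}^\top$ is dually equivalent to the category $\mathbb{DP}_{fin}$ of finite DP-algebras and their homomorphisms.
   Context: For an integer $k>0$, $\mathbf{k}$ denotes the $k$-element chain. A DP-algebra is a member of the variety of MTL-algebras (bounded commutative integral prelinear residuated lattices) generated by the MTL-chains in which $x*y=0$ whenever $x,y<1$ and $x*y=\min\{x,y\}$ otherwise. $\mathsf{HF}$ is the category of finite hall forests: objects are finite multisets of pairs $(T,J)$ with $T$ a finite tree (a poset with a minimum in which the downset of each element is a chain) and $J$ a possibly empty finite chain; a morphism $h\colon\{(T_i,J_i)\}_{i\in I}\to\{(T_k,J_k)\}_{k\in K}$ is a family $\{(f_i,g_i)\}_{i\in I}$ such that for each $i$ there is $k\in K$ with $f_i\colon T_i\to T_k$ and $g_i\colon J_i\to J_k$ order-preserving, downset-preserving maps, with $g_i(\max J_i)=\max J_k$; if $J_k$ is empty, $g_i$ is the partial, nowhere defined map. $\mathsf{MC}$ is the category whose objects are finite multisets of nonempty finite chains and whose morphisms $h\colon\{C_1,\dots,C_m\}\to\{D_1,\dots,D_n\}$ are families $h=\{h_i\}_{i=1}^m$ where each $h_i\colon C_i\twoheadrightarrow D_j$ is an order-preserving surjection onto some $D_j$. $\mathsf{MC}^\top$ is the non-full subcategory of $\mathsf{MC}$ with the same objects whose morphisms additionally satisfy: for each $i$, if the target $D_j$ of $h_i$ is not isomorphic to $\mathbf{1}$,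 then $h_i^{ -1}(\max D_j)=\{\max C_i\}$. -}

module Defs where

import Level as L
open import Data.Nat using (ℕ; zero; suc)
open import Data.Fin using (Fin; fromℕ) renaming (_≤_ to _≤F_; zero to fzero; suc to fsuc)
open import Data.Fin.Properties using (≤-trans; ≤-refl)
open import Data.Bool using (Bool; T)
open import Data.Product using (Σ; ∃; _×_; _,_; proj₁; proj₂)
open import Data.Sum using (_⊎_)
open import Data.Unit using (⊤; tt)
open import Data.Empty using (⊥; ⊥-elim)
open import Relation.Nullary using (¬_)
open import Relation.Binary.PropositionalEquality
  using (_≡_; _≢_; refl; sym; trans; cong; cong₂; subst)
open import Function using (_∘_; id; _↔_)

record RawCat (o h e : L.Level) : Set (L.suc (o L.⊔ h L.⊔ e)) where
  infixr 9 _⊚_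
  field
    Obj  : Set o
    Hom  : Obj → Obj → Set h
    _≈_  : ∀ {a b} → Hom a b → Hom a b → Set e
    idC  : ∀ {a} → Hom a a
    _⊚_  : ∀ {a b c} → Hom b c → Hom a b → Hom a c

op : ∀ {o h e} → RawCat o h e → RawCat o h e
op C = record
  { Obj = Obj ; Hom = λ a b → Hom b a ; _≈_ = _≈_ ; idC = idC
  ; _⊚_ = λ g f → f ⊚ g }
  where open RawCat C

record Functor {o h e o' h' e'} (C : RawCat o h e) (D : RawCat o' h' e')
       : Set (o L.⊔ h L.⊔ e L.⊔ o' L.⊔ h' L.⊔ e') where
  private
    module C = RawCat C
    module D = RawCat D
  field
    F₀      : C.Obj → D.Obj
    F₁      : ∀ {a b} → C.Hom a b → D.Hom (F₀ a) (F₀ b)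
    resp    : ∀ {a b} {f g : C.Hom a b} → f C.≈ g → F₁ f D.≈ F₁ g
    pres-id : ∀ {a} → F₁ (C.idC {a}) D.≈ D.idC
    pres-∘  : ∀ {a b c} (g : C.Hom b c) (f : C.Hom a b) →
              F₁ (g C.⊚ f) D.≈ (F₁ g D.⊚ F₁ f)

record Iso {o h e} (C : RawCat o h e) (a b : RawCat.Obj C) : Set (h L.⊔ e) where
  open RawCat C
  field
    fwd   : Hom a b
    bwd   : Hom b a
    left  : (bwd ⊚ fwd) ≈ idC
    right : (fwd ⊚ bwd) ≈ idC

record Equivalence {o h e o' h' e'} (C : RawCat o h e) (D : RawCat o' h' e')
       : Set (o L.⊔ h L.⊔ e L.⊔ o' L.⊔ h' L.⊔ e') where
  private
    module C = RawCat C
    module D = RawCat D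
  field
    F : Functor C D
    G : Functor D C
  open Functor F renaming (F₀ to F₀; F₁ to F₁)
  open Functor G renaming (F₀ to G₀; F₁ to G₁)
  field
    η     : ∀ a → Iso C (G₀ (F₀ a)) a
    η-nat : ∀ {a b} (f : C.Hom a b) →
            (Iso.fwd (η b) C.⊚ G₁ (F₁ f)) C.≈ (f C.⊚ Iso.fwd (η a))
    ε     : ∀ b → Iso D (F₀ (G₀ b)) b
    ε-nat : ∀ {a b} (f : D.Hom a b) →
            (Iso.fwd (ε b) D.⊚ F₁ (G₁ f)) D.≈ (f D.⊚ Iso.fwd (ε a))

DualEquivalence : ∀ {o h e o' h' e'} → RawCat o h e → RawCat o' h' e' → Set _
DualEquivalence C D = Equivalence C (op D)

-- Finite chains: the k-element chain is Fin k with its usual order.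

Mono : ∀ {m n} → (Fin m → Fin n) → Set
Mono g = ∀ x y → x ≤F y → g x ≤F g y

Surj : ∀ {m n} → (Fin m → Fin n) → Set
Surj g = ∀ y → ∃ λ x → g x ≡ y

-- The category MC^⊤.
-- An object is a finite multiset {C_1,…,C_n} of nonempty finite chains;
-- chain i is Fin (suc (len i)).

record MCObj : Set where
  field
    n   : ℕ
    len : Fin n → ℕ
open MCObj public

Chain : (A : MCObj) → Fin (n A) → Set
Chain A i = Fin (suc (len A i))

top : (A : MCObj) (i : Fin (n A)) → Chain A i
top A i = fromℕ (len A i)

record MCTHom (A B : MCObj) : Set where
  field
    idx  : Fin (n A) → Fin (n B)
    map  : ∀ i → Chain A i → Chain B (idx i)
    mono : ∀ i → Mono (map i)
    surj : ∀ i → Surj (map i)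
    -- if the target chain D_j is not (isomorphic to) 𝟏, i.e. has ≠ 1 element,
    -- then h_i⁻¹(max D_j) = {max C_i}
    topc : ∀ i → len B (idx i) ≢ 0 →
           ∀ x → map i x ≡ top B (idx i) → x ≡ top A i
open MCTHom public

MCTEq : ∀ {A B} → MCTHom A B → MCTHom A B → Set
MCTEq {A} {B} f g =
  ∀ i x → _≡_ {A = Σ (Fin (n B)) (Chain B)} (idx f i , map f i x) (idx g i , map g i x)

MCT-id : ∀ {A} → MCTHom A A
MCT-id = record
  { idx = id ; map = λ i x → x ; mono = λ i x y p → p
  ; surj = λ i y → y , refl ; topc = λ i _ x p → p }

private
  one-surj : ∀ {k} (g : Fin 1 → Fin (suc k)) → Surj g → k ≢ 0 → ⊥
  one-surj {zero} g s k≢0 = k≢0 refl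
  one-surj {suc k} g s _ with s fzero | s (fsuc fzero)
  ... | fzero , p | fzero , q with trans (sym p) q
  ...   | ()

  surj-len : ∀ {d e} (g : Fin (suc d) → Fin (suc e)) → Surj g → e ≢ 0 → d ≢ 0
  surj-len {zero} g s e≢0 _ = one-surj g s e≢0
  surj-len {suc d} g s e≢0 ()

MCT-comp : ∀ {A B C} → MCTHom B C → MCTHom A B → MCTHom A C
MCT-comp {A} {B} {C} g f = record
  { idx  = λ i → idx g (idx f i)
  ; map  = λ i x → map g (idx f i) (map f i x)
  ; mono = λ i x y p → mono g (idx f i) _ _ (mono f i x y p)
  ; surj = λ i z → let (y , q) = surj g (idx f i) z
                       (x , r) = surj f i y
                   in x , trans (cong (map g (idx f i)) r) q
  ; topc = λ i e≢0 x p →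
      topc f i (surj-len (map g (idx f i)) (surj g (idx f i)) e≢0) x
               (topc g (idx f i) e≢0 (map f i x) p)
  }

MCT : RawCat L.zero L.zero L.zero
MCT = record
  { Obj = MCObj ; Hom = MCTHom ; _≈_ = MCTEq ; idC = MCT-id ; _⊚_ = MCT-comp }

record Tree : Set where
  field
    size    : ℕ
    le      : Fin size → Fin size → Bool
    refl⊑   : ∀ x → T (le x x)
    antisym : ∀ x y → T (le x y) → T (le y x) → x ≡ y
    trans⊑  : ∀ x y z → T (le x y) → T (le y z) → T (le x z)
    bot     : Fin size
    bot-min : ∀ x → T (le bot x)
    downset-chain : ∀ x y z → T (le y x) → T (le z x) → T (le y z) ⊎ T (le z y)
open Tree public

record TreeHom (S S' : Tree) : Set where
  field
    tmap  : Fin (size S) → Fin (size S')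
    tmono : ∀ x y → T (le S x y) → T (le S' (tmap x) (tmap y))
    tdown : ∀ x y → T (le S' y (tmap x)) → ∃ λ z → T (le S z x) × tmap z ≡ y
open TreeHom public

TreeHom-id : ∀ {S} → TreeHom S S
TreeHom-id = record { tmap = id ; tmono = λ x y p → p ; tdown = λ x y p → y , p , refl }

TreeHom-comp : ∀ {S S' S''} → TreeHom S' S'' → TreeHom S S' → TreeHom S S''
TreeHom-comp g f = record
  { tmap = λ x → tmap g (tmap f x)
  ; tmono = λ x y p → tmono g _ _ (tmono f x y p)
  ; tdown = λ x y p → let (z' , q , r) = tdown g (tmap f x) y p
                          (z , q' , r') = tdown f x z' q
                      in z , q' , trans (cong (tmap g) r') r }

-- Possibly empty finite chains J: the chain Fin m (m = 0 is the empty chain).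
-- Downset-preserving for a map of chains.
DownPres : ∀ {m n} → (Fin m → Fin n) → Set
DownPres g = ∀ x y → y ≤F g x → ∃ λ z → z ≤F x × g z ≡ y

-- Morphisms of the chain components J_i → J_k:
--  * J_k empty: the unique nowhere defined partial map;
--  * J_k nonempty, J_i empty: none (g(max J_i) = max J_k cannot hold);
--  * both nonempty: order- and downset-preserving g with g(max) = max.
ChainHom : ℕ → ℕ → Set
ChainHom m zero = ⊤
ChainHom zero (suc n) = ⊥
ChainHom (suc m) (suc n) =
  Σ (Fin (suc m) → Fin (suc n)) λ g → Mono g × DownPres g × g (fromℕ m) ≡ fromℕ n

ChainEq : ∀ {m n} → ChainHom m n → ChainHom m n → Set
ChainEq {m} {zero} _ _ = ⊤
ChainEq {zero} {suc n} () _
ChainEq {suc m} {suc n} g g' = ∀ x → proj₁ g x ≡ proj₁ g' x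

ChainHom-id : ∀ {m} → ChainHom m m
ChainHom-id {zero} = tt
ChainHom-id {suc m} = id , (λ x y p → p) , (λ x y p → y , p , refl) , refl

ChainHom-comp : ∀ {m n p} → ChainHom n p → ChainHom m n → ChainHom m p
ChainHom-comp {m} {n} {zero} _ _ = tt
ChainHom-comp {m} {zero} {suc p} () _
ChainHom-comp {zero} {suc n} {suc p} _ ()
ChainHom-comp {suc m} {suc n} {suc p} (k , mk , dk , tk) (g , mg , dg , tg) =
  (λ x → k (g x)) , (λ x y q → mk _ _ (mg x y q)) ,
  (λ x y q → let (z' , q₁ , r₁) = dk (g x) y q
                 (z , q₂ , r₂) = dg x z' q₁
             in z , q₂ , trans (cong k r₂) r₁) ,
  trans (cong k tg) tk

record HFObj : Set where
  field
    hn    : ℕ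
    tree  : Fin hn → Tree
    chain : Fin hn → ℕ      -- J_i is the chain Fin (chain i)
open HFObj public

record HFHom (A B : HFObj) : Set where
  field
    hidx : Fin (hn A) → Fin (hn B)
    f    : ∀ i → TreeHom (tree A i) (tree B (hidx i))
    g    : ∀ i → ChainHom (chain A i) (chain B (hidx i))
open HFHom public

HFEq : ∀ {A B} → HFHom A B → HFHom A B → Set
HFEq {A} {B} h h' = ∀ i → Σ (hidx h i ≡ hidx h' i) λ p →
  (∀ x → subst (λ k → Fin (size (tree B k))) p (tmap (f h i) x) ≡ tmap (f h' i) x) ×
  ChainEq (subst (λ k → ChainHom (chain A i) (chain B k)) p (g h i)) (g h' i)

HF-id : ∀ {A} → HFHom A A
HF-id = record { hidx = id ; f = λ i → TreeHom-id ; g = λ i → ChainHom-id }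

HF-comp : ∀ {A B C} → HFHom B C → HFHom A B → HFHom A C
HF-comp k h = record
  { hidx = λ i → hidx k (hidx h i)
  ; f = λ i → TreeHom-comp (f k (hidx h i)) (f h i)
  ; g = λ i → ChainHom-comp (g k (hidx h i)) (g h i) }

HF : RawCat L.zero L.zero L.zero
HF = record { Obj = HFObj ; Hom = HFHom ; _≈_ = HFEq ; idC = HF-id ; _⊚_ = HF-comp }

HF𝟏 : RawCat L.zero L.zero L.zero
HF𝟏 = record
  { Obj = Σ HFObj (λ A → ∀ i → size (tree A i) ≡ 1)
  ; Hom = λ A B → HFHom (proj₁ A) (proj₁ B)
  ; _≈_ = HFEq ; idC = HF-id ; _⊚_ = HF-comp }

record MTL : Set₁ where
  infixr 7 _∧_ _⊙_
  infixr 6 _∨_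
  infixr 5 _⇒_
  field
    Carrier : Set
    _∧_ _∨_ _⊙_ _⇒_ : Carrier → Carrier → Carrier
    𝟘 𝟙 : Carrier
  _≤_ : Carrier → Carrier → Set
  x ≤ y = x ∧ y ≡ x
  field
    ∧-comm  : ∀ x y → x ∧ y ≡ y ∧ x
    ∧-assoc : ∀ x y z → (x ∧ y) ∧ z ≡ x ∧ (y ∧ z)
    ∨-comm  : ∀ x y → x ∨ y ≡ y ∨ x
    ∨-assoc : ∀ x y z → (x ∨ y) ∨ z ≡ x ∨ (y ∨ z)
    ∧-absorb : ∀ x y → x ∧ (x ∨ y) ≡ x
    ∨-absorb : ∀ x y → x ∨ (x ∧ y) ≡ x
    𝟘-least : ∀ x → 𝟘 ∧ x ≡ 𝟘
    𝟙-greatest : ∀ x → x ∧ 𝟙 ≡ x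
    ⊙-comm  : ∀ x y → x ⊙ y ≡ y ⊙ x
    ⊙-assoc : ∀ x y z → (x ⊙ y) ⊙ z ≡ x ⊙ (y ⊙ z)
    ⊙-unit  : ∀ x → x ⊙ 𝟙 ≡ x
    res→ : ∀ x y z → (x ⊙ y) ≤ z → x ≤ (y ⇒ z)
    res← : ∀ x y z → x ≤ (y ⇒ z) → (x ⊙ y) ≤ z
    prelin : ∀ x y → (x ⇒ y) ∨ (y ⇒ x) ≡ 𝟙
open MTL public

record IsDPChain (A : MTL) : Set where
  field
    total   : ∀ x y → _≤_ A x y ⊎ _≤_ A y x
    drastic : ∀ x y → x ≢ 𝟙 A → y ≢ 𝟙 A → _⊙_ A x y ≡ 𝟘 A
    minimum : ∀ x y → (x ≡ 𝟙 A ⊎ y ≡ 𝟙 A) → _⊙_ A x y ≡ _∧_ A x y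

data Term : Set where
  var : ℕ → Term
  t𝟘 t𝟙 : Term
  _t∧_ _t∨_ _t⊙_ _t⇒_ : Term → Term → Term

⟦_⟧ : Term → (A : MTL) → (ℕ → Carrier A) → Carrier A
⟦ var i ⟧ A v = v i
⟦ t𝟘 ⟧ A v = 𝟘 A
⟦ t𝟙 ⟧ A v = 𝟙 A
⟦ s t∧ t ⟧ A v = _∧_ A (⟦ s ⟧ A v) (⟦ t ⟧ A v)
⟦ s t∨ t ⟧ A v = _∨_ A (⟦ s ⟧ A v) (⟦ t ⟧ A v)
⟦ s t⊙ t ⟧ A v = _⊙_ A (⟦ s ⟧ A v) (⟦ t ⟧ A v)
⟦ s t⇒ t ⟧ A v = _⇒_ A (⟦ s ⟧ A v) (⟦ t ⟧ A v)

-- A is a DP-algebra iff it belongs to the variety generated by the DP-chains,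
-- i.e. (Birkhoff) it satisfies every equation valid in all DP-chains.
IsDP : MTL → Set₁
IsDP A = ∀ (s t : Term) →
  (∀ (C : MTL) → IsDPChain C → ∀ (v : ℕ → Carrier C) → ⟦ s ⟧ C v ≡ ⟦ t ⟧ C v) →
  ∀ (v : ℕ → Carrier A) → ⟦ s ⟧ A v ≡ ⟦ t ⟧ A v

record FinDP : Set₁ where
  field
    alg    : MTL
    isDP   : IsDP alg
    finite : Σ ℕ λ k → Carrier alg ↔ Fin k
open FinDP public

record MTLHom (A B : MTL) : Set where
  field
    fun : Carrier A → Carrier B
    h∧ : ∀ x y → fun (_∧_ A x y) ≡ _∧_ B (fun x) (fun y)
    h∨ : ∀ x y → fun (_∨_ A x y) ≡ _∨_ B (fun x) (fun y)
    h⊙ : ∀ x y → fun (_⊙_ A x y) ≡ _⊙_ B (fun x) (fun y)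
    h⇒ : ∀ x y → fun (_⇒_ A x y) ≡ _⇒_ B (fun x) (fun y)
    h𝟘 : fun (𝟘 A) ≡ 𝟘 B
    h𝟙 : fun (𝟙 A) ≡ 𝟙 B
open MTLHom public

MTLHom-id : ∀ {A} → MTLHom A A
MTLHom-id = record
  { fun = id ; h∧ = λ _ _ → refl ; h∨ = λ _ _ → refl ; h⊙ = λ _ _ → refl
  ; h⇒ = λ _ _ → refl ; h𝟘 = refl ; h𝟙 = refl }

MTLHom-comp : ∀ {A B C} → MTLHom B C → MTLHom A B → MTLHom A C
MTLHom-comp k h = record
  { fun = λ x → fun k (fun h x)
  ; h∧ = λ x y → trans (cong (fun k) (h∧ h x y)) (h∧ k _ _)
  ; h∨ = λ x y → trans (cong (fun k) (h∨ h x y)) (h∨ k _ _)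
  ; h⊙ = λ x y → trans (cong (fun k) (h⊙ h x y)) (h⊙ k _ _)
  ; h⇒ = λ x y → trans (cong (fun k) (h⇒ h x y)) (h⇒ k _ _)
  ; h𝟘 = trans (cong (fun k) (h𝟘 h)) (h𝟘 k)
  ; h𝟙 = trans (cong (fun k) (h𝟙 h)) (h𝟙 k) }

DPfin : RawCat (L.suc L.zero) L.zero L.zero
DPfin = record
  { Obj = FinDP
  ; Hom = λ A B → MTLHom (alg A) (alg B)
  ; _≈_ = λ h k → ∀ x → fun h x ≡ fun k x
  ; idC = MTLHom-id
  ; _⊚_ = MTLHom-comp }

{-# OPTIONS --safe #-}

-- Removing the top element of every chain turns the surjections of MC^⊤ into the
-- downset-preserving maps of HF, since a component whose target is not 𝟏 sends the top,
-- and nothing but the top, to the top.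
--
-- For the duality, {C_1,…,C_m} is sent to the product of the DP-chains whose nonzero elements
-- form C_1,…,C_m.  Homomorphisms of nontrivial DP-chains are embeddings preserving 0, 1 and (if the
-- source has more than two elements) the coatom; their adjoints are exactly the components of
-- MC^⊤.  A homomorphism from a product to a chain factors through one projection, which gives
-- full faithfulness.  Conversely, in a DP-algebra every square x ⊙ x is Boolean, because in a
-- DP-chain it is 0 or 1.  If e is an atom of the Boolean elements of a finite A, then
-- (x ⇒ y)² ∨ (y ⇒ x)² = 1 makes the quotient by the filter of e a chain, and A is the product
-- of these quotients.

module Submission where

open import Defs
import Level as L
import Algebra.Construct.NaturalChoice.Max
import Algebra.Construct.NaturalChoice.Min
import Algebra.Construct.NaturalChoice.MinMaxOp
open import Data.Bool using (true)
open import Data.Empty using (⊥; ⊥-elim)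
open import Data.Fin using (Fin; zero; suc; toℕ; fromℕ; fromℕ<; inject₁; lower₁; punchIn; punchOut)
  renaming (_≤_ to _≤F_; _<_ to _<F_)
import Data.Fin.Properties as Fin
open import Data.Fin.Relation.Unary.Top using (view; ‵fromℕ; ‵inject₁; view-fromℕ; view-inject₁)
open import Data.Nat using (ℕ; zero; suc; z≤n; s≤s)
import Data.Nat as ℕ
import Data.Nat.Properties as ℕ
open import Data.Product using (Σ; ∃; _×_; _,_; proj₁; proj₂)
open import Data.Product.Function.NonDependent.Propositional using (_×-↔_)
import Data.Sum
open import Data.Sum using (_⊎_; inj₁; inj₂)
open import Data.Unit using (⊤; tt)
import Function
open import Function using (_∘_; case_of_; _⇔_; mk⇔; _↔_)
open import Function.Properties.Inverse using (↔-refl; ↔-sym; ↔-trans)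
open import Relation.Binary.PropositionalEquality
  using (_≡_; _≢_; refl; sym; trans; cong; cong₂; subst; subst₂; module ≡-Reasoning)
open import Relation.Nullary using (¬_; Dec; yes; no; _×-dec_; _⊎-dec_; ¬?)
open import Relation.Nullary.Decidable using (map′)
open Function.Equivalence using (to; from)

-- Equivalences from fully faithful functors

-- The categories are bare data, so laws have to be supplied. Faithfulness turns every equation in
-- MC^⊤ into one in the target, so only the two targets are shown to be categories; lifts and
-- preimages of objects are explicit data from which the inverse functors are built.
--
-- One exception shapes both equivalences: the condition on tops is waived when the target is 𝟏. In
-- HF this case is the nowhere defined map into the empty chain. Among DP-chains, 𝟏 corresponds to
-- the two-element chain, whose coatom is 0; in a longer chain the coatom is the negation of every
-- element strictly between 0 and 1, and therefore homomorphisms must preserve it.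
--
-- Membership in the variety transfers equations only, and the generating chains are arbitrary, so
-- the facts about Boolean elements are proved as identities in possibly infinite DP-chains.
-- Finiteness of the algebra then supplies decidable equality, and with it the search for atoms and
-- the ranking of each quotient.

record IsCategory {o h e} (C : RawCat o h e) : Set (o L.⊔ h L.⊔ e) where
  open RawCat C
  field
    ≈-refl  : ∀ {a b} {f : Hom a b} → f ≈ f
    ≈-sym   : ∀ {a b} {f g : Hom a b} → f ≈ g → g ≈ f
    ≈-trans : ∀ {a b} {f g k : Hom a b} → f ≈ g → g ≈ k → f ≈ k
    ⊚-cong  : ∀ {a b c} {f f' : Hom b c} {g g' : Hom a b} →
              f ≈ f' → g ≈ g' → (f ⊚ g) ≈ (f' ⊚ g')
    assoc   : ∀ {a b c d} (f : Hom c d) (g : Hom b c) (k : Hom a b) →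
              ((f ⊚ g) ⊚ k) ≈ (f ⊚ (g ⊚ k))
    idˡ     : ∀ {a b} (f : Hom a b) → (idC ⊚ f) ≈ f
    idʳ     : ∀ {a b} (f : Hom a b) → (f ⊚ idC) ≈ f

record FullyFaithful {o h e o' h' e'} {C : RawCat o h e} {D : RawCat o' h' e'}
       (F : Functor C D) : Set (o L.⊔ h L.⊔ e L.⊔ h' L.⊔ e') where
  private
    module C = RawCat C
    module D = RawCat D
  open Functor F
  field
    lift     : ∀ {a b} → D.Hom (F₀ a) (F₀ b) → C.Hom a b
    F₁-lift  : ∀ {a b} (k : D.Hom (F₀ a) (F₀ b)) → F₁ (lift k) D.≈ k
    faithful : ∀ {a b} {k l : C.Hom a b} → F₁ k D.≈ F₁ l → k C.≈ l

module _ {o h e o' h' e'} {C : RawCat o h e} {D : RawCat o' h' e'}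
         (D-cat : IsCategory D) (F : Functor C D) (F-ff : FullyFaithful F)
         (G₀ : RawCat.Obj D → RawCat.Obj C)
         (ε : ∀ d → Iso D (Functor.F₀ F (G₀ d)) d) where
  private
    module C = RawCat C
    module D = RawCat D
    module ε d = Iso (ε d)
  open IsCategory D-cat
  open Functor F
  open FullyFaithful F-ff

  private
    cancelˡ : ∀ {a b c} {u : D.Hom b c} {v : D.Hom c b} → (u D.⊚ v) D.≈ D.idC →
              (k : D.Hom a c) → (u D.⊚ (v D.⊚ k)) D.≈ k
    cancelˡ uv k = ≈-trans (≈-sym (assoc _ _ k)) (≈-trans (⊚-cong uv ≈-refl) (idˡ k))

    conj : ∀ {a b} → D.Hom a b → D.Hom (F₀ (G₀ a)) (F₀ (G₀ b))
    conj {a} {b} k = ε.bwd b D.⊚ (k D.⊚ ε.fwd a)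

    conj-⊚ : ∀ {a b c} (k : D.Hom b c) (l : D.Hom a b) →
             conj (k D.⊚ l) D.≈ (conj k D.⊚ conj l)
    conj-⊚ {a} {b} {c} k l =
      ≈-trans (⊚-cong ≈-refl (≈-trans (assoc k l _)
        (⊚-cong ≈-refl (≈-sym (cancelˡ (ε.right b) _)))))
      (≈-trans (⊚-cong ≈-refl (≈-sym (assoc k _ _))) (≈-sym (assoc _ _ _)))

    F₁-lift-⊚ : ∀ {a b c} {k : D.Hom (F₀ b) (F₀ c)} {l : D.Hom (F₀ a) (F₀ b)} →
                   F₁ (lift k C.⊚ lift l) D.≈ (k D.⊚ l)
    F₁-lift-⊚ = ≈-trans (pres-∘ _ _) (⊚-cong (F₁-lift _) (F₁-lift _))

    G : Functor D C
    G = record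
      { F₀ = G₀
      ; F₁ = λ k → lift (conj k)
      ; resp = λ p → faithful (≈-trans (F₁-lift _)
          (≈-trans (⊚-cong ≈-refl (⊚-cong p ≈-refl)) (≈-sym (F₁-lift _))))
      ; pres-id = λ {a} → faithful (≈-trans (F₁-lift _)
          (≈-trans (⊚-cong ≈-refl (idˡ _)) (≈-trans (ε.left a) (≈-sym pres-id))))
      ; pres-∘ = λ k l → faithful (≈-trans (F₁-lift _)
          (≈-trans (conj-⊚ k l) (≈-sym F₁-lift-⊚)))
      }

  -- `G` conjugates by `ε` and lifts, so naturality of `ε` is a cancellation. `η` is the lift of `ε`
  -- at `F₀ a`, and each of its equations is pulled back along `faithful`.
  ff+split-eso⇒equivalence : Equivalence C D
  ff+split-eso⇒equivalence = record
    { F = F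
    ; G = G
    ; η = λ a → record
        { fwd = lift (ε.fwd (F₀ a))
        ; bwd = lift (ε.bwd (F₀ a))
        ; left = faithful (≈-trans F₁-lift-⊚ (≈-trans (ε.left (F₀ a)) (≈-sym pres-id)))
        ; right = faithful (≈-trans F₁-lift-⊚ (≈-trans (ε.right (F₀ a)) (≈-sym pres-id))) }
    ; η-nat = λ {a} {b} k → faithful (≈-trans F₁-lift-⊚
        (≈-trans (cancelˡ (ε.right (F₀ b)) _)
        (≈-trans (⊚-cong ≈-refl (≈-sym (F₁-lift _))) (≈-sym (pres-∘ _ _)))))
    ; ε = ε
    ; ε-nat = λ {a} {b} k →
        ≈-trans (⊚-cong ≈-refl (F₁-lift _)) (cancelˡ (ε.right b) _)
    }

-- Hall forests with one-point trees

-- One component of a morphism of MC^⊤. The indices are the lengths left after the tops are removed,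
-- so `b ≢ 0` says that the target is not 𝟏.
record TopSurj (a b : ℕ) : Set where
  constructor topSurj
  field
    fn   : Fin (suc a) → Fin (suc b)
    fn-mono : Mono fn
    fn-surj : Surj fn
    fn-topc : b ≢ 0 → ∀ x → fn x ≡ fromℕ b → x ≡ fromℕ a
open TopSurj

inject₁-mono : ∀ {m} {x y : Fin m} → x ≤F y → inject₁ x ≤F inject₁ y
inject₁-mono {x = x} {y} = subst₂ ℕ._≤_ (sym (Fin.toℕ-inject₁ x)) (sym (Fin.toℕ-inject₁ y))

inject₁-cancel : ∀ {m} {x y : Fin m} → inject₁ x ≤F inject₁ y → x ≤F y
inject₁-cancel {x = x} {y} = subst₂ ℕ._≤_ (Fin.toℕ-inject₁ x) (Fin.toℕ-inject₁ y)

fromℕ≤⇒≡ : ∀ {m} {x : Fin (suc m)} → fromℕ m ≤F x → x ≡ fromℕ m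
fromℕ≤⇒≡ {x = x} p = Fin.≤-antisym (Fin.≤fromℕ x) p

mono-surj-top : ∀ {a b} (h : Fin (suc a) → Fin (suc b)) → Mono h → Surj h → h (fromℕ a) ≡ fromℕ b
mono-surj-top {a} {b} h m s with s (fromℕ b)
... | x , p = fromℕ≤⇒≡ (subst (_≤F h (fromℕ a)) p (m x (fromℕ a) (Fin.≤fromℕ x)))

fn-top : ∀ {a b} (h : TopSurj a b) → fn h (fromℕ a) ≡ fromℕ b
fn-top h = mono-surj-top (fn h) (fn-mono h) (fn-surj h)

module Restrict {a b} (h : TopSurj (suc a) (suc b)) where
  below-top : ∀ x → suc b ≢ toℕ (fn h (inject₁ x))
  below-top x p = Fin.fromℕ≢inject₁ (sym (fn-topc h (λ ()) (inject₁ x)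
    (Fin.toℕ-injective (trans (sym p) (sym (Fin.toℕ-fromℕ (suc b)))))))

  rmap : Fin (suc a) → Fin (suc b)
  rmap x = lower₁ (fn h (inject₁ x)) (below-top x)

  inject₁-rmap : ∀ x → inject₁ (rmap x) ≡ fn h (inject₁ x)
  inject₁-rmap x = Fin.inject₁-lower₁ _ (below-top x)

  rmap-mono : Mono rmap
  rmap-mono x y p = inject₁-cancel (subst₂ _≤F_ (sym (inject₁-rmap x)) (sym (inject₁-rmap y))
    (fn-mono h _ _ (inject₁-mono p)))

  rmap-surj : Surj rmap
  rmap-surj y with fn-surj h (inject₁ y)
  ... | x , p with view x
  ...   | ‵fromℕ = ⊥-elim (Fin.fromℕ≢inject₁ (trans (sym (fn-top h)) p))
  ...   | ‵inject₁ z = z , Fin.inject₁-injective (trans (inject₁-rmap z) p)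

-- Take any preimage `z` of `y`. If it is not below `x`, then `h x ≤ y ≤ h x` and `x` itself is a
-- preimage.
mono-surj⇒downPres : ∀ {a b} {h : Fin a → Fin b} → Mono h → Surj h → DownPres h
mono-surj⇒downPres {h = h} m s x y y≤hx with s y
... | z , p with Fin.≤-total z x
...   | inj₁ z≤x = z , z≤x , p
...   | inj₂ x≤z = x , Fin.≤-refl , Fin.≤-antisym (subst (h x ≤F_) p (m x z x≤z)) y≤hx

-- Counterpart of the emptiness of `ChainHom zero (suc b)`.
no-topSurj-from-𝟏 : ∀ {b} → TopSurj 0 (suc b) → ⊥
no-topSurj-from-𝟏 h with fn-surj h zero
... | zero , p with trans (sym p) (fn-top h)
...   | ()

restrict : ∀ a b → TopSurj a b → ChainHom a b
restrict a zero h = tt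
restrict zero (suc b) h = no-topSurj-from-𝟏 h
restrict (suc a) (suc b) h =
  rmap , rmap-mono , mono-surj⇒downPres rmap-mono rmap-surj , mono-surj-top rmap rmap-mono rmap-surj
  where open Restrict h

extendMap : ∀ a b → ChainHom a b → Fin (suc a) → Fin (suc b)
extendMap a zero _ _ = zero
extendMap (suc a) (suc b) (k , _) x with view x
... | ‵fromℕ = fromℕ (suc b)
... | ‵inject₁ z = inject₁ (k z)

extendMap-top : ∀ a b (k : ChainHom a b) → extendMap a b k (fromℕ a) ≡ fromℕ b
extendMap-top a zero k = refl
extendMap-top (suc a) (suc b) k rewrite view-fromℕ (suc a) = refl

extendMap-inject₁ : ∀ a b (k : ChainHom (suc a) (suc b)) x →
                    extendMap (suc a) (suc b) k (inject₁ x) ≡ inject₁ (proj₁ k x)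
extendMap-inject₁ a b k x rewrite view-inject₁ x = refl

extendMap-mono : ∀ a b (k : ChainHom a b) → Mono (extendMap a b k)
extendMap-mono a zero k x y p = z≤n
extendMap-mono (suc a) (suc b) k@(_ , m , _) x y p with view y
... | ‵fromℕ = Fin.≤fromℕ (extendMap (suc a) (suc b) k x)
... | ‵inject₁ y' with view x
...   | ‵fromℕ = ⊥-elim (Fin.fromℕ≢inject₁ (sym (fromℕ≤⇒≡ p)))
...   | ‵inject₁ x' = inject₁-mono (m x' y' (inject₁-cancel p))

extendMap-surj : ∀ a b (k : ChainHom a b) → Surj (extendMap a b k)
extendMap-surj a zero k zero = zero , refl
extendMap-surj (suc a) (suc b) k@(_ , _ , d , t) y with view y
... | ‵fromℕ = fromℕ (suc a) , extendMap-top (suc a) (suc b) k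
-- The maximum goes to the maximum, so every `y'` lies below an image and downset preservation
-- supplies its preimage.
... | ‵inject₁ y' with d (fromℕ a) y' (subst (y' ≤F_) (sym t) (Fin.≤fromℕ y'))
...   | x , _ , p = inject₁ x , trans (extendMap-inject₁ a b k x) (cong inject₁ p)

extendMap-topc : ∀ a b (k : ChainHom a b) → b ≢ 0 → ∀ x → extendMap a b k x ≡ fromℕ b → x ≡ fromℕ a
extendMap-topc a zero k b≢0 = ⊥-elim (b≢0 refl)
extendMap-topc (suc a) (suc b) k _ x p with view x
... | ‵fromℕ = refl
... | ‵inject₁ _ = ⊥-elim (Fin.fromℕ≢inject₁ (sym p))

extend : ∀ a b → ChainHom a b → TopSurj a b
extend a b k = topSurj (extendMap a b k) (extendMap-mono a b k) (extendMap-surj a b k) (extendMap-topc a b k)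

restrict-extend : ∀ a b (k : ChainHom a b) → ChainEq {a} {b} (restrict a b (extend a b k)) k
restrict-extend a zero k = tt
restrict-extend (suc a) (suc b) k x =
  Fin.inject₁-injective (trans (Restrict.inject₁-rmap (extend (suc a) (suc b) k) x) (extendMap-inject₁ a b k x))

restrict-cong : ∀ a b (h h' : TopSurj a b) → (∀ x → fn h x ≡ fn h' x) →
                ChainEq {a} {b} (restrict a b h) (restrict a b h')
restrict-cong a zero h h' p = tt
restrict-cong zero (suc b) h h' p = ⊥-elim (no-topSurj-from-𝟏 h)
restrict-cong (suc a) (suc b) h h' p x =
  Fin.inject₁-injective (trans (Restrict.inject₁-rmap h x)
    (trans (p (inject₁ x)) (sym (Restrict.inject₁-rmap h' x))))

-- For `b = 0` the restriction remembers nothing, and nothing is lost, because the target has only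
-- one element.
restrict-injective : ∀ a b (h h' : TopSurj a b) →
                     ChainEq {a} {b} (restrict a b h) (restrict a b h') → ∀ x → fn h x ≡ fn h' x
restrict-injective a zero h h' _ x with fn h x | fn h' x
... | zero | zero = refl
restrict-injective zero (suc b) h _ _ x = ⊥-elim (no-topSurj-from-𝟏 h)
restrict-injective (suc a) (suc b) h h' p x with view x
... | ‵fromℕ = trans (fn-top h) (sym (fn-top h'))
... | ‵inject₁ z = trans (sym (Restrict.inject₁-rmap h z))
                     (trans (cong inject₁ (p z)) (Restrict.inject₁-rmap h' z))

restrict-id : ∀ a (h : TopSurj a a) → (∀ x → fn h x ≡ x) → ChainEq {a} {a} (restrict a a h) ChainHom-id
restrict-id zero h p = tt
restrict-id (suc a) h p x = Fin.inject₁-injective (trans (Restrict.inject₁-rmap h x) (p (inject₁ x)))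

-- The composite `r` is known only pointwise, so its proof fields may be whichever ones `MCT-comp`
-- produces.
restrict-comp : ∀ a b c (h : TopSurj a b) (l : TopSurj b c) (r : TopSurj a c) →
                (∀ x → fn r x ≡ fn l (fn h x)) →
                ChainEq {a} {c} (restrict a c r)
                  (ChainHom-comp {a} {b} {c} (restrict b c l) (restrict a b h))
restrict-comp a b zero h l r p = tt
restrict-comp a zero (suc c) h l r p = ⊥-elim (no-topSurj-from-𝟏 l)
restrict-comp zero (suc b) (suc c) h l r p = ⊥-elim (no-topSurj-from-𝟏 h)
restrict-comp (suc a) (suc b) (suc c) h l r p x =
  Fin.inject₁-injective (trans (Restrict.inject₁-rmap r x)
    (trans (trans (p _) (cong (fn l) (sym (Restrict.inject₁-rmap h x))))
           (sym (Restrict.inject₁-rmap l _))))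

-- Category laws of finite hall forests

ChainEq-refl : ∀ m n (k : ChainHom m n) → ChainEq {m} {n} k k
ChainEq-refl m zero k = tt
ChainEq-refl (suc m) (suc n) k x = refl

ChainEq-sym : ∀ m n {k l : ChainHom m n} → ChainEq {m} {n} k l → ChainEq {m} {n} l k
ChainEq-sym m zero p = tt
ChainEq-sym (suc m) (suc n) p x = sym (p x)

ChainEq-trans : ∀ m n {k l r : ChainHom m n} →
                ChainEq {m} {n} k l → ChainEq {m} {n} l r → ChainEq {m} {n} k r
ChainEq-trans m zero p q = tt
ChainEq-trans (suc m) (suc n) p q x = trans (p x) (q x)

ChainHom-comp-cong : ∀ m n p {k k' : ChainHom n p} {l l' : ChainHom m n} →
                     ChainEq {n} {p} k k' → ChainEq {m} {n} l l' →
                     ChainEq {m} {p} (ChainHom-comp {m} {n} {p} k l) (ChainHom-comp {m} {n} {p} k' l')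
ChainHom-comp-cong m n zero _ _ = tt
ChainHom-comp-cong (suc m) (suc n) (suc p) {k' = k'} {l} q r x = trans (q _) (cong (proj₁ k') (r x))

ChainHom-comp-assoc : ∀ m n p q (k : ChainHom p q) (l : ChainHom n p) (r : ChainHom m n) →
  ChainEq {m} {q} (ChainHom-comp {m} {n} {q} (ChainHom-comp {n} {p} {q} k l) r)
                  (ChainHom-comp {m} {p} {q} k (ChainHom-comp {m} {n} {p} l r))
ChainHom-comp-assoc m n p zero k l r = tt
ChainHom-comp-assoc (suc m) (suc n) (suc p) (suc q) k l r x = refl

ChainHom-idˡ : ∀ m n (k : ChainHom m n) →
               ChainEq {m} {n} (ChainHom-comp {m} {n} {n} (ChainHom-id {n}) k) k
ChainHom-idˡ m zero k = tt
ChainHom-idˡ (suc m) (suc n) k x = refl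

ChainHom-idʳ : ∀ m n (k : ChainHom m n) →
               ChainEq {m} {n} (ChainHom-comp {m} {m} {n} k (ChainHom-id {m})) k
ChainHom-idʳ m zero k = tt
ChainHom-idʳ (suc m) (suc n) k x = refl

-- HFEq h h' is, for each i, the relation CompEq on the i-th components; unlike
-- hidx h i, the index in the first component of CompEq can be matched against refl.

Comp : Tree → ℕ → HFObj → Set
Comp S m B = Σ (Fin (hn B)) λ j → TreeHom S (tree B j) × ChainHom m (chain B j)

CompEq : ∀ {S m} B → Comp S m B → Comp S m B → Set
CompEq {S} {m} B (j , u , k) (j' , u' , k') = Σ (j ≡ j') λ p →
  (∀ x → subst (λ l → Fin (size (tree B l))) p (tmap u x) ≡ tmap u' x) ×
  ChainEq {m} {chain B j'} (subst (λ l → ChainHom m (chain B l)) p k) k'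

CompEq-sym : ∀ {S m} B {c d : Comp S m B} → CompEq B c d → CompEq B d c
CompEq-sym {m = m} B {j , _} (refl , p , q) =
  refl , (λ x → sym (p x)) , ChainEq-sym m (chain B j) q

CompEq-trans : ∀ {S m} B {c d e : Comp S m B} → CompEq B c d → CompEq B d e → CompEq B c e
CompEq-trans {m = m} B {j , _} (refl , p , q) (refl , p' , q') =
  refl , (λ x → trans (p x) (p' x)) , ChainEq-trans m (chain B j) q q'

component : ∀ {A B} → HFHom A B → ∀ i → Comp (tree A i) (chain A i) B
component h i = hidx h i , f h i , g h i

_⊚ᶜ_ : ∀ {S m B C} → HFHom B C → Comp S m B → Comp S m C
_⊚ᶜ_ {m = m} {B} {C} h (j , u , k) =
  hidx h j , TreeHom-comp (f h j) u , ChainHom-comp {m} {chain B j} {chain C (hidx h j)} (g h j) k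

⊚ᶜ-congˡ : ∀ {S m B C} {h h' : HFHom B C} → HFEq h h' → (c : Comp S m B) → CompEq C (h ⊚ᶜ c) (h' ⊚ᶜ c)
⊚ᶜ-congˡ {S} {m} {B} {C} {h} {h'} p (j , u , k) = go (component h j) (component h' j) (p j)
  where
  go : (c d : Comp (tree B j) (chain B j) C) → CompEq C c d →
       CompEq C (proj₁ c , TreeHom-comp (proj₁ (proj₂ c)) u ,
                 ChainHom-comp {m} {chain B j} {chain C (proj₁ c)} (proj₂ (proj₂ c)) k)
                (proj₁ d , TreeHom-comp (proj₁ (proj₂ d)) u ,
                 ChainHom-comp {m} {chain B j} {chain C (proj₁ d)} (proj₂ (proj₂ d)) k)
  go c d (refl , p , q) = refl , (λ x → p (tmap u x)) ,
    ChainHom-comp-cong m (chain B j) (chain C (proj₁ c)) q (ChainEq-refl m (chain B j) k)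

⊚ᶜ-congʳ : ∀ {S m B C} (h : HFHom B C) {c d : Comp S m B} → CompEq B c d → CompEq C (h ⊚ᶜ c) (h ⊚ᶜ d)
⊚ᶜ-congʳ {m = m} {B} {C} h {j , _} (refl , p , q) = refl , (λ x → cong (tmap (f h j)) (p x)) ,
  ChainHom-comp-cong m (chain B j) (chain C (hidx h j)) (ChainEq-refl (chain B j) (chain C (hidx h j)) (g h j)) q

HF-isCategory : IsCategory HF
HF-isCategory = record
  { ≈-refl = λ {A} {B} {h} i → refl , (λ _ → refl) , ChainEq-refl (chain A i) (chain B (hidx h i)) (g h i)
  ; ≈-sym = λ {A} {B} {h} {k} p i → CompEq-sym B {component h i} {component k i} (p i)
  ; ≈-trans = λ {A} {B} {h} {k} {l} p q i →
      CompEq-trans B {component h i} {component k i} {component l i} (p i) (q i)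
  ; ⊚-cong = λ {A} {B} {C} {h} {h'} {k} {k'} p q i →
      CompEq-trans C {h ⊚ᶜ component k i} {h' ⊚ᶜ component k i} {h' ⊚ᶜ component k' i}
        (⊚ᶜ-congˡ {h = h} {h'} p (component k i))
        (⊚ᶜ-congʳ h' {component k i} {component k' i} (q i))
  ; assoc = λ {A} {B} {C} {D} h k l i → refl , (λ _ → refl) ,
      ChainHom-comp-assoc (chain A i) (chain B (hidx l i)) (chain C (hidx k (hidx l i)))
        (chain D (hidx h (hidx k (hidx l i)))) (g h _) (g k _) (g l i)
  ; idˡ = λ {A} {B} h i → refl , (λ _ → refl) , ChainHom-idˡ (chain A i) (chain B (hidx h i)) (g h i)
  ; idʳ = λ {A} {B} h i → refl , (λ _ → refl) , ChainHom-idʳ (chain A i) (chain B (hidx h i)) (g h i)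
  }

HF𝟏-isCategory : IsCategory HF𝟏
HF𝟏-isCategory = record
  { ≈-refl = λ {_} {_} {h} → ≈-refl {f = h}
  ; ≈-sym = λ {_} {_} {h} {k} → ≈-sym {f = h} {k}
  ; ≈-trans = λ {_} {_} {h} {k} {l} → ≈-trans {f = h} {k} {l}
  ; ⊚-cong = λ {_} {_} {_} {h} {h'} {k} {k'} → ⊚-cong {f = h} {h'} {k} {k'}
  ; assoc = assoc ; idˡ = idˡ ; idʳ = idʳ }
  where open IsCategory HF-isCategory

-- The functor that removes tops

point : Tree
point = record
  { size = 1 ; le = λ _ _ → true ; refl⊑ = λ _ → tt ; antisym = λ { zero zero _ _ → refl }
  ; trans⊑ = λ _ _ _ _ _ → tt ; bot = zero ; bot-min = λ _ → tt
  ; downset-chain = λ _ _ _ _ _ → inj₁ tt }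

singleton-unique : ∀ {m} → m ≡ 1 → (x y : Fin m) → x ≡ y
singleton-unique refl zero zero = refl

collapse : ∀ S S' → size S ≡ 1 → size S' ≡ 1 → TreeHom S S'
collapse S S' p p' = record
  { tmap = λ _ → bot S' ; tmono = λ _ _ _ → refl⊑ S' (bot S')
  ; tdown = λ x y _ → x , refl⊑ S x , singleton-unique p' _ _ }

dropTops₀ : MCObj → RawCat.Obj HF𝟏
dropTops₀ A = record { hn = n A ; tree = λ _ → point ; chain = len A } , λ _ → refl

componentMC : ∀ {A B} (h : MCTHom A B) i → TopSurj (len A i) (len B (idx h i))
componentMC h i = topSurj (map h i) (mono h i) (surj h i) (topc h i)

dropTops₁ : ∀ {A B} → MCTHom A B → RawCat.Hom HF𝟏 (dropTops₀ A) (dropTops₀ B)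
dropTops₁ {A} {B} h = record
  { hidx = idx h
  ; f = λ _ → TreeHom-id
  ; g = λ i → restrict (len A i) (len B (idx h i)) (componentMC h i) }

MCComp : ℕ → MCObj → Set
MCComp a B = Σ (Fin (n B)) λ j → TopSurj a (len B j)

MCCompEq : ∀ {a} B → MCComp a B → MCComp a B → Set
MCCompEq B (j , h) (j' , h') = ∀ x → _≡_ {A = Σ (Fin (n B)) (Chain B)} (j , fn h x) (j' , fn h' x)

MCCompEq⇒≡ : ∀ {a} B {j} {h h' : TopSurj a (len B j)} → MCCompEq B (j , h) (j , h') → ∀ x → fn h x ≡ fn h' x
MCCompEq⇒≡ B {j} {h} {h'} p x = second (p x)
  where
  second : ∀ {y y' : Chain B j} → _≡_ {A = Σ (Fin (n B)) (Chain B)} (j , y) (j , y') → y ≡ y'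
  second refl = refl

restrictComp : ∀ {a} B → MCComp a B → Comp point a (proj₁ (dropTops₀ B))
restrictComp {a} B (j , h) = j , TreeHom-id , restrict a (len B j) h

restrictComp-resp : ∀ {a} B (c d : MCComp a B) → MCCompEq B c d →
                    CompEq (proj₁ (dropTops₀ B)) (restrictComp B c) (restrictComp B d)
-- Chains are nonempty, so agreement at the single point `zero` already identifies the two targets.
restrictComp-resp {a} B (j , h) (j' , h') p with cong proj₁ (p zero)
... | refl = refl , (λ _ → refl) , restrict-cong a (len B j) h h' (MCCompEq⇒≡ B {h = h} {h'} p)

restrictComp-reflect : ∀ {a} B (c d : MCComp a B) →
                       CompEq (proj₁ (dropTops₀ B)) (restrictComp B c) (restrictComp B d) → MCCompEq B c d
restrictComp-reflect {a} B (j , h) (_ , h') (refl , _ , q) x =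
  cong (j ,_) (restrict-injective a (len B j) h h' q x)

dropTops : Functor MCT HF𝟏
dropTops = record
  { F₀ = dropTops₀
  ; F₁ = dropTops₁
  ; resp = λ {A} {B} {h} {k} p i →
      restrictComp-resp B (idx h i , componentMC h i) (idx k i , componentMC k i) (p i)
  ; pres-id = λ {A} i → refl , (λ _ → refl) ,
      restrict-id (len A i) (componentMC {A} MCT-id i) (λ _ → refl)
  ; pres-∘ = λ {A} {B} {C} k h i → refl , (λ _ → refl) ,
      restrict-comp (len A i) (len B (idx h i)) (len C (idx k (idx h i)))
        (componentMC h i) (componentMC k (idx h i)) (componentMC (MCT-comp k h) i) (λ _ → refl)
  }

dropTops-ff : FullyFaithful dropTops
dropTops-ff = record
  { lift = λ {A} {B} k → record
      { idx = hidx k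
      ; map = λ i → fn (ext {A} {B} k i)
      ; mono = λ i → fn-mono (ext {A} {B} k i)
      ; surj = λ i → fn-surj (ext {A} {B} k i)
      ; topc = λ i → fn-topc (ext {A} {B} k i) }
  ; F₁-lift = λ {A} {B} k i → refl , (λ x → singleton-unique refl _ _) ,
      restrict-extend (len A i) (len B (hidx k i)) (g k i)
  ; faithful = λ {A} {B} {h} {k} p i →
      restrictComp-reflect B (idx h i , componentMC h i) (idx k i , componentMC k i) (p i)
  }
  where
  ext : ∀ {A B} (k : RawCat.Hom HF𝟏 (dropTops₀ A) (dropTops₀ B)) i →
        TopSurj (len A i) (len B (hidx k i))
  ext {A} {B} k i = extend (len A i) (len B (hidx k i)) (g k i)

addTops₀ : RawCat.Obj HF𝟏 → MCObj
addTops₀ (A , _) = record { n = hn A ; len = chain A }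

dropTops-addTops : ∀ A → Iso HF𝟏 (dropTops₀ (addTops₀ A)) A
dropTops-addTops (A , single) = record
  { fwd = record { hidx = λ i → i ; f = λ i → collapse point (tree A i) refl (single i) ; g = λ i → ChainHom-id }
  ; bwd = record { hidx = λ i → i ; f = λ i → collapse (tree A i) point (single i) refl ; g = λ i → ChainHom-id }
  ; left = λ i → refl , (λ x → singleton-unique refl _ _) , ChainHom-idˡ (chain A i) (chain A i) ChainHom-id
  ; right = λ i → refl , (λ x → singleton-unique (single i) _ _) , ChainHom-idˡ (chain A i) (chain A i) ChainHom-id
  }

MCT≃HF𝟏 : Equivalence MCT HF𝟏
MCT≃HF𝟏 = ff+split-eso⇒equivalence HF𝟏-isCategory dropTops dropTops-ff addTops₀ dropTops-addTops

-- MTL-algebras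

module MTLProperties (M : MTL) where
  open MTL M public
    using ()
    renaming ( Carrier to X; _∧_ to _⊓_; _∨_ to _⊔_; _⊙_ to _·_; _⇒_ to _↝_; 𝟘 to 0#; 𝟙 to 1#
             ; _≤_ to _≼_ )
  private module M = MTL M

  ⊓-idem : ∀ x → x ⊓ x ≡ x
  ⊓-idem x = trans (cong (x ⊓_) (sym (M.∨-absorb x x))) (M.∧-absorb x (x ⊓ x))

  ≼-refl : ∀ {x} → x ≼ x
  ≼-refl {x} = ⊓-idem x

  ≼-reflexive : ∀ {x y} → x ≡ y → x ≼ y
  ≼-reflexive refl = ≼-refl

  ≼-trans : ∀ {x y z} → x ≼ y → y ≼ z → x ≼ z
  ≼-trans {x} {y} {z} p q =
    trans (cong (_⊓ z) (sym p)) (trans (M.∧-assoc x y z) (trans (cong (x ⊓_) q) p))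

  ≼-antisym : ∀ {x y} → x ≼ y → y ≼ x → x ≡ y
  ≼-antisym {x} {y} p q = trans (sym p) (trans (M.∧-comm x y) q)

  ⊓-lower₂ : ∀ x y → (x ⊓ y) ≼ y
  ⊓-lower₂ x y = trans (M.∧-assoc x y y) (cong (x ⊓_) (⊓-idem y))

  ⊓-lower₁ : ∀ x y → (x ⊓ y) ≼ x
  ⊓-lower₁ x y = subst (_≼ x) (M.∧-comm y x) (⊓-lower₂ y x)

  ⊓-glb : ∀ {x y z} → z ≼ x → z ≼ y → z ≼ (x ⊓ y)
  ⊓-glb {x} {y} {z} p q = trans (sym (M.∧-assoc z x y)) (trans (cong (_⊓ y) p) q)

  ≼⇒⊔ : ∀ {x y} → x ≼ y → x ⊔ y ≡ y
  ≼⇒⊔ {x} {y} p =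
    trans (M.∨-comm x y) (trans (cong (y ⊔_) (trans (sym p) (M.∧-comm x y))) (M.∨-absorb y x))

  ⊔-upper₂ : ∀ x y → y ≼ (x ⊔ y)
  ⊔-upper₂ x y = trans (cong (y ⊓_) (M.∨-comm x y)) (M.∧-absorb y x)

  ⊔-lub : ∀ {x y z} → x ≼ z → y ≼ z → (x ⊔ y) ≼ z
  ⊔-lub {x} {y} {z} p q = trans (cong ((x ⊔ y) ⊓_) (sym eq)) (M.∧-absorb (x ⊔ y) z)
    where
    eq : (x ⊔ y) ⊔ z ≡ z
    eq = trans (M.∨-assoc x y z) (trans (cong (x ⊔_) (≼⇒⊔ q)) (≼⇒⊔ p))

  0#-min : ∀ {x} → 0# ≼ x
  0#-min = M.𝟘-least _

  1#-max : ∀ {x} → x ≼ 1#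
  1#-max = M.𝟙-greatest _

  ≼0#⇒≡ : ∀ {x} → x ≼ 0# → x ≡ 0#
  ≼0#⇒≡ p = ≼-antisym p 0#-min

  1#≼⇒≡ : ∀ {x} → 1# ≼ x → x ≡ 1#
  1#≼⇒≡ p = ≼-antisym 1#-max p

  ·-monoˡ : ∀ z {x y} → x ≼ y → (x · z) ≼ (y · z)
  ·-monoˡ z {x} {y} p = M.res← x z (y · z) (≼-trans p (M.res→ y z (y · z) ≼-refl))

  ·-monoʳ : ∀ z {x y} → x ≼ y → (z · x) ≼ (z · y)
  ·-monoʳ z {x} {y} p = subst₂ _≼_ (M.⊙-comm x z) (M.⊙-comm y z) (·-monoˡ z p)

  1#-unitˡ : ∀ x → 1# · x ≡ x
  1#-unitˡ x = trans (M.⊙-comm 1# x) (M.⊙-unit x)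

  ·-lower₁ : ∀ x y → (x · y) ≼ x
  ·-lower₁ x y = subst ((x · y) ≼_) (M.⊙-unit x) (·-monoʳ x 1#-max)

  ·-lower₂ : ∀ x y → (x · y) ≼ y
  ·-lower₂ x y = subst ((x · y) ≼_) (1#-unitˡ y) (·-monoˡ y 1#-max)

  0#-zeroˡ : ∀ x → 0# · x ≡ 0#
  0#-zeroˡ x = ≼0#⇒≡ (·-lower₁ 0# x)

  ≼⇒↝≡1# : ∀ {x y} → x ≼ y → x ↝ y ≡ 1#
  ≼⇒↝≡1# {x} {y} p = 1#≼⇒≡ (M.res→ 1# x y (≼-trans (≼-reflexive (1#-unitˡ x)) p))

  ↝≡1#⇒≼ : ∀ {x y} → x ↝ y ≡ 1# → x ≼ y
  ↝≡1#⇒≼ {x} {y} p = ≼-trans (≼-reflexive (sym (1#-unitˡ x))) (M.res← 1# x y (≼-reflexive (sym p)))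

  modus-ponens : ∀ x y → (x · (x ↝ y)) ≼ y
  modus-ponens x y = ≼-trans (≼-reflexive (M.⊙-comm x (x ↝ y))) (M.res← (x ↝ y) x y ≼-refl)

  1#-↝ : ∀ y → 1# ↝ y ≡ y
  1#-↝ y = ≼-antisym (≼-trans (≼-reflexive (sym (1#-unitˡ (1# ↝ y)))) (modus-ponens 1# y))
                     (M.res→ y 1# y (≼-reflexive (M.⊙-unit y)))

-- Finite DP-chains

-- The carrier has `m + 2` elements: a chain of length `suc m` and a new `0`. Hence `0` and `1`
-- always differ, and `coatom` is `0` exactly when `m = 0`.
module DrasticChain (m : ℕ) where
  private
    module Min = Algebra.Construct.NaturalChoice.Min (Fin.≤-totalOrder (suc (suc m)))
    module Max = Algebra.Construct.NaturalChoice.Max (Fin.≤-totalOrder (suc (suc m)))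
    module MinMax = Algebra.Construct.NaturalChoice.MinMaxOp Min.minOperator Max.maxOperator

  D : Set
  D = Fin (suc (suc m))

  topD coatom : D
  topD = fromℕ (suc m)
  coatom = inject₁ (fromℕ m)

  mul : D → D → D
  mul x y with x Fin.≟ topD | y Fin.≟ topD
  ... | yes _ | _     = y
  ... | no _  | yes _ = x
  ... | no _  | no _  = zero

  -- In the last case `z · x` is `0` for every `z` below the top and is `x`, hence not below `y`,
  -- for the top; the largest admissible `z` is the coatom.
  imp : D → D → D
  imp x y with x Fin.≤? y | x Fin.≟ topD
  ... | yes _ | _     = topD
  ... | no _  | yes _ = y
  ... | no _  | no _  = coatom

  ≤coatom : ∀ {x} → x ≢ topD → x ≤F coatom
  ≤coatom {x} p with view x
  ... | ‵fromℕ = ⊥-elim (p refl)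
  ... | ‵inject₁ z = inject₁-mono (Fin.≤fromℕ z)

  ≤coatom⇒≢ : ∀ {x} → x ≤F coatom → x ≢ topD
  ≤coatom⇒≢ p refl = Fin.fromℕ≢inject₁ (sym (fromℕ≤⇒≡ p))

  mul-topˡ : ∀ y → mul topD y ≡ y
  mul-topˡ y with topD Fin.≟ topD | y Fin.≟ topD
  ... | yes _ | _ = refl
  ... | no p  | _ = ⊥-elim (p refl)

  mul-topʳ : ∀ x → mul x topD ≡ x
  mul-topʳ x with x Fin.≟ topD | topD Fin.≟ topD
  ... | yes p | _ = sym p
  ... | no _  | yes _ = refl
  ... | no _  | no p = ⊥-elim (p refl)

  mul-drastic : ∀ {x y} → x ≢ topD → y ≢ topD → mul x y ≡ zero
  mul-drastic {x} {y} p q with x Fin.≟ topD | y Fin.≟ topD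
  ... | yes p' | _      = ⊥-elim (p p')
  ... | no _   | yes q' = ⊥-elim (q q')
  ... | no _   | no _   = refl

  imp-≤ : ∀ {x y} → x ≤F y → imp x y ≡ topD
  imp-≤ {x} {y} p with x Fin.≤? y | x Fin.≟ topD
  ... | yes _ | _ = refl
  ... | no q  | _ = ⊥-elim (q p)

  imp-topˡ : ∀ y → imp topD y ≡ y
  imp-topˡ y with topD Fin.≤? y | topD Fin.≟ topD
  ... | yes p | _     = sym (fromℕ≤⇒≡ p)
  ... | no _  | yes _ = refl
  ... | no _  | no p  = ⊥-elim (p refl)

  imp-coatom : ∀ {x y} → ¬ x ≤F y → x ≢ topD → imp x y ≡ coatom
  imp-coatom {x} {y} p q with x Fin.≤? y | x Fin.≟ topD
  ... | yes p' | _      = ⊥-elim (p p')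
  ... | no _   | yes q' = ⊥-elim (q q')
  ... | no _   | no _   = refl

  mul-comm : ∀ x y → mul x y ≡ mul y x
  mul-comm x y with x Fin.≟ topD | y Fin.≟ topD
  ... | yes p | yes q = trans q (sym p)
  ... | yes _ | no _  = refl
  ... | no _  | yes _ = refl
  ... | no _  | no _  = refl

  mul-zeroˡ : ∀ y → mul zero y ≡ zero
  mul-zeroˡ y with y Fin.≟ topD
  ... | yes _ = refl
  ... | no _  = refl

  mul-zeroʳ : ∀ x → mul x zero ≡ zero
  mul-zeroʳ x = trans (mul-comm x zero) (mul-zeroˡ x)

  mul-assoc : ∀ x y z → mul (mul x y) z ≡ mul x (mul y z)
  mul-assoc x y z = go (x Fin.≟ topD) (y Fin.≟ topD) (z Fin.≟ topD)
    where
    go : Dec (x ≡ topD) → Dec (y ≡ topD) → Dec (z ≡ topD) → mul (mul x y) z ≡ mul x (mul y z)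
    go (yes refl) _ _ = trans (cong (λ w → mul w z) (mul-topˡ y)) (sym (mul-topˡ (mul y z)))
    go (no _) (yes refl) _ = trans (cong (λ w → mul w z) (mul-topʳ x)) (cong (mul x) (sym (mul-topˡ z)))
    go (no _) (no _) (yes refl) = trans (mul-topʳ (mul x y)) (cong (mul x) (sym (mul-topʳ y)))
    go (no p) (no q) (no r) =
      trans (trans (cong (λ w → mul w z) (mul-drastic p q)) (mul-zeroˡ z))
            (sym (trans (cong (mul x) (mul-drastic q r)) (mul-zeroʳ x)))

  mul≤ʳ : ∀ x y → mul x y ≤F y
  mul≤ʳ x y with x Fin.≟ topD | y Fin.≟ topD
  ... | yes _ | _        = Fin.≤-refl
  ... | no _  | yes refl = Fin.≤fromℕ x
  ... | no _  | no _     = z≤n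

  residual→ : ∀ x y z → mul x y ≤F z → x ≤F imp y z
  residual→ x y z p = go (y Fin.≤? z) (y Fin.≟ topD)
    where
    go : Dec (y ≤F z) → Dec (y ≡ topD) → x ≤F imp y z
    go (yes y≤z) _ = subst (x ≤F_) (sym (imp-≤ y≤z)) (Fin.≤fromℕ x)
    go (no _) (yes refl) = subst₂ _≤F_ (mul-topʳ x) (sym (imp-topˡ z)) p
    go (no y≰z) (no y≢) = subst (x ≤F_) (sym (imp-coatom y≰z y≢))
      (≤coatom λ { refl → y≰z (subst (_≤F z) (mul-topˡ y) p) })

  residual← : ∀ x y z → x ≤F imp y z → mul x y ≤F z
  residual← x y z p = go (y Fin.≤? z) (y Fin.≟ topD)
    where
    go : Dec (y ≤F z) → Dec (y ≡ topD) → mul x y ≤F z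
    go (yes y≤z) _ = Fin.≤-trans (mul≤ʳ x y) y≤z
    go (no _) (yes refl) = subst₂ _≤F_ (sym (mul-topʳ x)) (imp-topˡ z) p
    go (no y≰z) (no y≢) = subst (_≤F z) (sym (mul-drastic x≢ y≢)) z≤n
      where x≢ = ≤coatom⇒≢ (subst (x ≤F_) (imp-coatom y≰z y≢) p)

  ≤⇒⊓ : ∀ {x y} → x ≤F y → x Min.⊓ y ≡ x
  ≤⇒⊓ = Min.x≤y⇒x⊓y≈x

  ⊓⇒≤ : ∀ {x y} → x Min.⊓ y ≡ x → x ≤F y
  ⊓⇒≤ = Min.x⊓y≈x⇒x≤y

  prelinear : ∀ x y → imp x y Max.⊔ imp y x ≡ topD
  prelinear x y with Fin.≤-total x y
  ... | inj₁ p = trans (cong (Max._⊔ imp y x) (imp-≤ p)) (Max.⊔-zeroˡ Fin.≤fromℕ (imp y x))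
  ... | inj₂ p = trans (cong (imp x y Max.⊔_) (imp-≤ p)) (Max.⊔-zeroʳ Fin.≤fromℕ (imp x y))

  drasticChain : MTL
  drasticChain = record
    { Carrier = D
    ; _∧_ = Min._⊓_ ; _∨_ = Max._⊔_ ; _⊙_ = mul ; _⇒_ = imp ; 𝟘 = zero ; 𝟙 = topD
    ; ∧-comm = Min.⊓-comm ; ∧-assoc = Min.⊓-assoc
    ; ∨-comm = Max.⊔-comm ; ∨-assoc = Max.⊔-assoc
    ; ∧-absorb = MinMax.⊓-absorbs-⊔ ; ∨-absorb = MinMax.⊔-absorbs-⊓
    ; 𝟘-least = λ x → ≤⇒⊓ {zero} {x} z≤n ; 𝟙-greatest = λ x → ≤⇒⊓ (Fin.≤fromℕ x)
    ; ⊙-comm = mul-comm ; ⊙-assoc = mul-assoc ; ⊙-unit = mul-topʳ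
    ; res→ = λ x y z p → ≤⇒⊓ (residual→ x y z (⊓⇒≤ p))
    ; res← = λ x y z p → ≤⇒⊓ (residual← x y z (⊓⇒≤ p))
    ; prelin = prelinear }

  ≤⇒⊔ : ∀ {x y} → x ≤F y → x Max.⊔ y ≡ y
  ≤⇒⊔ = Max.x≤y⇒x⊔y≈y

  drasticChain-isDPChain : IsDPChain drasticChain
  drasticChain-isDPChain = record
    { total = λ x y → Data.Sum.map ≤⇒⊓ ≤⇒⊓ (Fin.≤-total x y)
    ; drastic = λ x y → mul-drastic
    ; minimum = λ { x y (inj₁ refl) → trans (mul-topˡ y) (sym (Min.⊓-identityˡ Fin.≤fromℕ y))
                  ; x y (inj₂ refl) → trans (mul-topʳ x) (sym (Min.⊓-identityʳ Fin.≤fromℕ x)) } }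

-- Duality for single chains

open DrasticChain using (drasticChain; drasticChain-isDPChain; topD; coatom)

-- A decidable downset of a finite chain is an initial segment. The cut is its size, which may be
-- `m` itself; hence `Fin (suc m)`.
cut : ∀ {m} {P : Fin m → Set} → (∀ i → Dec (P i)) → (∀ i j → i ≤F j → P j → P i) →
      Σ (Fin (suc m)) λ c → ∀ i → i <F c ⇔ P i
cut {zero} P? down = zero , λ ()
cut {suc m} P? down with P? zero
... | no ¬p = zero , λ i → mk⇔ (λ ()) (λ p → ⊥-elim (¬p (down zero i z≤n p)))
... | yes p with cut (P? ∘ suc) (λ i j i≤j → down (suc i) (suc j) (s≤s i≤j))
...   | c , spec = suc c , λ { zero → mk⇔ (λ _ → p) (λ _ → s≤s z≤n)
                             ; (suc i) → mk⇔ (λ { (s≤s q) → to (spec i) q }) (λ q → s≤s (from (spec i) q)) }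

-- Were `b < a`, then `b` would be less than `m` and could serve as the test element: below `a` but
-- not below itself.
≤-by-lower-sets : ∀ {m} (a b : Fin (suc m)) → (∀ (i : Fin m) → i <F a → i <F b) → a ≤F b
≤-by-lower-sets {m} a b sub with a Fin.≤? b
... | yes p = p
... | no ¬p = ⊥-elim (ℕ.<-irrefl refl (subst (ℕ._< toℕ b) i≡b (sub i (subst (ℕ._< toℕ a) (sym i≡b) b<a))))
  where
  b<a : b <F a
  b<a = ℕ.≰⇒> ¬p
  b<m : toℕ b ℕ.< m
  b<m = ℕ.<-≤-trans b<a (ℕ.s≤s⁻¹ (Fin.toℕ<n a))
  i = fromℕ< b<m
  i≡b = Fin.toℕ-fromℕ< b<m

-- Embeddings of chains are the upper adjoints of their duals: h p < y iff p < k y, where the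
-- join-irreducibles of drasticChain m are identified with Fin (suc m) by p ↦ suc p.

Adjoint : ∀ {a b} → (Fin (suc a) → Fin (suc b)) → (Fin (suc (suc b)) → Fin (suc (suc a))) → Set
Adjoint h k = ∀ p y → h p <F y ⇔ p <F k y

-- The tool for all equations between dual maps: identities, composites and lifts are recognised by
-- the chain maps that they are adjoint to.
adjoint-unique : ∀ {a b} {h h' : Fin (suc a) → Fin (suc b)} {k k'} → Adjoint h k → Adjoint h' k' →
                 (∀ p → h p ≡ h' p) → ∀ y → k y ≡ k' y
adjoint-unique {k = k} {k'} adj adj' eq y = Fin.≤-antisym
  (≤-by-lower-sets (k y) (k' y) λ p → to (adj' p y) ∘ subst (_<F y) (eq p) ∘ from (adj p y))
  (≤-by-lower-sets (k' y) (k y) λ p → to (adj p y) ∘ subst (_<F y) (sym (eq p)) ∘ from (adj' p y))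

-- The test element is `suc b`, so `y` has to range over a chain with one more element.
≤-by-upper-sets : ∀ {m} (a b : Fin m) → (∀ (y : Fin (suc m)) → b <F y → a <F y) → a ≤F b
≤-by-upper-sets a b sub = ℕ.s≤s⁻¹ (sub (suc b) ℕ.≤-refl)

adjoint-injective : ∀ {a b} {h h' : Fin (suc a) → Fin (suc b)} {k k'} → Adjoint h k → Adjoint h' k' →
                    (∀ y → k y ≡ k' y) → ∀ p → h p ≡ h' p
adjoint-injective {h = h} {h'} adj adj' eq p = Fin.≤-antisym
  (≤-by-upper-sets (h p) (h' p) λ y → from (adj p y) ∘ subst (p <F_) (sym (eq y)) ∘ to (adj' p y))
  (≤-by-upper-sets (h' p) (h p) λ y → from (adj' p y) ∘ subst (p <F_) (eq y) ∘ to (adj p y))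

-- The order-theoretic content of a homomorphism between DP-chains. The proviso `b ≢ 0` in
-- `k-coatom` mirrors the one in `fn-topc`: for `b = 0` the coatom is `0` and must go to `0`.
record Embedding {a b} (k : Fin (suc (suc b)) → Fin (suc (suc a))) : Set where
  field
    k-mono    : ∀ x y → x ≤F y → k x ≤F k y
    k-cancel  : ∀ x y → k x ≤F k y → x ≤F y
    k-zero    : k zero ≡ zero
    k-top     : k (topD b) ≡ topD a
    k-coatom  : b ≢ 0 → k (coatom b) ≡ coatom a

  k-injective : ∀ {x y} → k x ≡ k y → x ≡ y
  k-injective {x} {y} p = Fin.≤-antisym (k-cancel x y (Fin.≤-reflexive p)) (k-cancel y x (Fin.≤-reflexive (sym p)))

  k-≢top : ∀ {x} → x ≢ topD b → k x ≢ topD a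
  k-≢top p q = p (k-injective (trans q (sym k-top)))

module _ {a b} (h : TopSurj a b) where
  private
    -- `k y` is the number of `p` with `h p < y`, the only value that the adjunction permits.
    kCut : (y : Fin (suc (suc b))) → Σ (Fin (suc (suc a))) λ c → ∀ p → p <F c ⇔ fn h p <F y
    kCut y = cut (λ p → fn h p Fin.<? y) (λ p q p≤q → ℕ.≤-<-trans (fn-mono h p q p≤q))

    k : Fin (suc (suc b)) → Fin (suc (suc a))
    k y = proj₁ (kCut y)

    adj : Adjoint (fn h) k
    adj p y = mk⇔ (from (proj₂ (kCut y) p)) (to (proj₂ (kCut y) p))

    -- This is where surjectivity of `h` enters: each `z < x` is some `h p`, and `p < k x ≤ k y`
    -- returns `z < y`.
    cancel : ∀ x y → k x ≤F k y → x ≤F y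
    cancel x y kx≤ky = ≤-by-lower-sets x y λ z z<x → let (p , hp≡z) = fn-surj h z in
      subst (_<F y) hp≡z (from (adj p y) (ℕ.<-≤-trans (to (adj p x) (subst (_<F x) (sym hp≡z) z<x)) kx≤ky))

    <coatom : ∀ {m} {p : Fin (suc m)} → p <F coatom m ⇔ p ≢ fromℕ m
    <coatom {m} {p} = mk⇔
      (λ { p<c refl → ℕ.<-irrefl (sym (Fin.toℕ-inject₁ (fromℕ m))) p<c })
      (λ p≢ → subst (toℕ p ℕ.<_) (sym (Fin.toℕ-inject₁ (fromℕ m)))
        (ℕ.≤∧≢⇒< (Fin.≤fromℕ p) (p≢ ∘ Fin.toℕ-injective)))

  dualMap : Fin (suc (suc b)) → Fin (suc (suc a))
  dualMap = k

  dualMap-adjoint : Adjoint (fn h) dualMap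
  dualMap-adjoint = adj

  dualMap-embedding : Embedding dualMap
  dualMap-embedding = record
    { k-mono = λ x y x≤y → ≤-by-lower-sets (k x) (k y) λ p p<kx →
        to (adj p y) (ℕ.<-≤-trans (from (adj p x) p<kx) x≤y)
    ; k-cancel = cancel
    ; k-zero = Fin.≤-antisym (≤-by-lower-sets (k zero) zero λ p p<k0 → ⊥-elim (ℕ.n≮0 (from (adj p zero) p<k0))) z≤n
    ; k-top = fromℕ≤⇒≡ (≤-by-lower-sets (topD a) (k (topD b)) λ p _ →
        to (adj p (topD b)) (s≤s (Fin.≤fromℕ (fn h p))))
    -- Being less than the coatom means being a `p` other than the top. Through the adjunction, the
    -- two inequalities become `fn-top` and `fn-topc`.
    ; k-coatom = λ b≢0 → Fin.≤-antisym
        (≤-by-lower-sets (k (coatom b)) (coatom a) λ p p<k → from <coatom λ p≡top →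
          to <coatom (from (adj p (coatom b)) p<k) (trans (cong (fn h) p≡top) (fn-top h)))
        (≤-by-lower-sets (coatom a) (k (coatom b)) λ p p<c → to (adj p (coatom b)) (from <coatom λ hp≡top →
          to <coatom p<c (fn-topc h b≢0 p hp≡top)))
    }

module _ {a b} {k : Fin (suc (suc b)) → Fin (suc (suc a))} (emb : Embedding k) where
  open Embedding emb
  private
    module A = DrasticChain a
    module B = DrasticChain b

    k-imp : ∀ x y → Dec (x ≤F y) → Dec (x ≡ topD b) → k (B.imp x y) ≡ A.imp (k x) (k y)
    k-imp x y (yes x≤y) _ = trans (cong k (B.imp-≤ x≤y)) (trans k-top (sym (A.imp-≤ (k-mono x y x≤y))))
    k-imp x y (no _) (yes refl) =
      trans (cong k (B.imp-topˡ y)) (sym (trans (cong (λ w → A.imp w (k y)) k-top) (A.imp-topˡ (k y))))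
    k-imp x y (no x≰y) (no x≢) =
      trans (cong k (B.imp-coatom x≰y x≢))
        (trans (k-coatom (b≢0 x x≰y x≢)) (sym (A.imp-coatom (x≰y ∘ k-cancel x y) (k-≢top x≢))))
      where
      -- In the two-element chain `x ≰ y` forces `x` to be the top, so this case needs a longer
      -- chain and `k-coatom` applies.
      b≢0 : ∀ {b'} (x : Fin (suc (suc b'))) {y : Fin (suc (suc b'))} → ¬ x ≤F y → x ≢ topD b' → b' ≢ 0
      b≢0 zero x≰y _ refl = x≰y z≤n
      b≢0 (suc zero) _ x≢ refl = x≢ refl

    k-mul : ∀ x y → Dec (x ≡ topD b) → Dec (y ≡ topD b) → k (B.mul x y) ≡ A.mul (k x) (k y)
    k-mul x y (yes refl) _ =
      trans (cong k (B.mul-topˡ y)) (sym (trans (cong (λ w → A.mul w (k y)) k-top) (A.mul-topˡ (k y))))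
    k-mul x y (no _) (yes refl) =
      trans (cong k (B.mul-topʳ x)) (sym (trans (cong (A.mul (k x)) k-top) (A.mul-topʳ (k x))))
    k-mul x y (no x≢) (no y≢) =
      trans (cong k (B.mul-drastic x≢ y≢)) (trans k-zero (sym (A.mul-drastic (k-≢top x≢) (k-≢top y≢))))

  embedding⇒hom : MTLHom (drasticChain b) (drasticChain a)
  embedding⇒hom = record
    { fun = k
    ; h∧ = ∧-hom
    ; h∨ = ∨-hom
    ; h⊙ = λ x y → k-mul x y (x Fin.≟ topD b) (y Fin.≟ topD b)
    ; h⇒ = λ x y → k-imp x y (x Fin.≤? y) (x Fin.≟ topD b)
    ; h𝟘 = k-zero
    ; h𝟙 = k-top }
    where
    ∧-hom : ∀ x y → k (_∧_ (drasticChain b) x y) ≡ _∧_ (drasticChain a) (k x) (k y)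
    ∧-hom x y with Fin.≤-total x y
    ... | inj₁ p = sym (A.≤⇒⊓ (k-mono x y p))
    ... | inj₂ p = sym (trans (∧-comm (drasticChain a) (k x) (k y)) (A.≤⇒⊓ (k-mono y x p)))
    ∨-hom : ∀ x y → k (_∨_ (drasticChain b) x y) ≡ _∨_ (drasticChain a) (k x) (k y)
    ∨-hom x y with Fin.≤-total y x
    ... | inj₂ p = sym (A.≤⇒⊔ (k-mono x y p))
    ... | inj₁ p = sym (trans (∨-comm (drasticChain a) (k x) (k y)) (A.≤⇒⊔ (k-mono y x p)))

dual : ∀ {a b} → TopSurj a b → MTLHom (drasticChain b) (drasticChain a)
dual h = embedding⇒hom (dualMap-embedding h)

module _ {a b} (K : MTLHom (drasticChain b) (drasticChain a)) where
  private
    module A = DrasticChain a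
    module B = DrasticChain b
    k = fun K

    mono′ : ∀ x y → x ≤F y → k x ≤F k y
    mono′ x y p = A.⊓⇒≤ (trans (sym (h∧ K x y)) (cong k (B.≤⇒⊓ p)))

    top≢0 : topD a ≢ zero
    top≢0 ()

    -- If x ≰ y then x ⇒ y is not 1, so its square is 0, whereas k x ≤ k y would send it to 1.
    cancel : ∀ x y → k x ≤F k y → x ≤F y
    cancel x y kx≤ky with x Fin.≤? y
    ... | yes p = p
    ... | no x≰y = ⊥-elim (top≢0 (begin
        topD a                               ≡⟨ A.mul-topˡ (topD a) ⟨
        A.mul (topD a) (topD a)              ≡⟨ cong₂ A.mul k-imp k-imp ⟨
        A.mul (k (B.imp x y)) (k (B.imp x y)) ≡⟨ h⊙ K _ _ ⟨
        k (B.mul (B.imp x y) (B.imp x y))    ≡⟨ cong k (B.mul-drastic imp≢ imp≢) ⟩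
        k zero                               ≡⟨ h𝟘 K ⟩
        zero                                 ∎))
      where
      open ≡-Reasoning
      k-imp : k (B.imp x y) ≡ topD a
      k-imp = trans (h⇒ K x y) (A.imp-≤ kx≤ky)
      imp≢ : B.imp x y ≢ topD b
      imp≢ p = x≰y (B.⊓⇒≤ (MTLProperties.↝≡1#⇒≼ (drasticChain b) p))

    coatom-nonzero : ∀ {b} → b ≢ 0 → ¬ coatom b ≤F zero {suc b}
    coatom-nonzero {zero} b≢0 _ = b≢0 refl

  hom⇒embedding : Embedding k
  hom⇒embedding = record
    { k-mono = mono′
    ; k-cancel = cancel
    ; k-zero = h𝟘 K
    ; k-top = h𝟙 K
    -- For `b ≢ 0` the coatom lies strictly between `0` and `1`, hence equals its own negation. Its
    -- image also lies strictly between, so the negation of the image is the coatom of the target.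
    ; k-coatom = λ b≢0 →
        let c≰0 = coatom-nonzero b≢0
            c≢⊤ = λ (p : coatom b ≡ topD b) → Fin.fromℕ≢inject₁ (sym p)
            kc≢⊤ = λ (p : k (coatom b) ≡ topD a) → B.≤coatom⇒≢ Fin.≤-refl
              (fromℕ≤⇒≡ (cancel (topD b) (coatom b) (Fin.≤-reflexive (trans (h𝟙 K) (sym p)))))
        in trans (cong k (sym (B.imp-coatom {coatom b} {zero} c≰0 c≢⊤)))
             (trans (h⇒ K (coatom b) zero) (A.imp-coatom
               (λ kc≤k0 → c≰0 (cancel (coatom b) zero kc≤k0)) kc≢⊤))
    }

module _ {a b} {k : Fin (suc (suc b)) → Fin (suc (suc a))} (emb : Embedding k) where
  open Embedding emb
  private
    -- `h p` counts the elements strictly between `0` and `1` that `k` sends to at most `p`, plus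
    -- nothing for the ends: `k` sends `0` below every `p` and the top above every `p`.
    hCut : (p : Fin (suc a)) → Σ (Fin (suc b)) λ c → ∀ y → y <F c ⇔ k (suc (inject₁ y)) ≤F p
    hCut p = cut (λ y → k (suc (inject₁ y)) Fin.≤? p)
      (λ y z y≤z → ℕ.≤-trans (k-mono (suc (inject₁ y)) (suc (inject₁ z)) (s≤s (inject₁-mono y≤z))))

    h : Fin (suc a) → Fin (suc b)
    h p = proj₁ (hCut p)

    adj : Adjoint h k
    adj p zero = mk⇔ (λ ()) (λ p<k0 → ⊥-elim (ℕ.n≮0 (subst (p <F_) k-zero p<k0)))
    adj p (suc y) with view y
    ... | ‵fromℕ = mk⇔ (λ _ → subst (p <F_) (sym k-top) (s≤s (Fin.≤fromℕ p))) (λ _ → s≤s (Fin.≤fromℕ (h p)))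
    ... | ‵inject₁ z = mk⇔
      (λ hp<y → ℕ.≰⇒> λ ky≤p → ℕ.<⇒≱ (from (proj₂ (hCut p) z) ky≤p)
        (subst (toℕ (h p) ℕ.≤_) (Fin.toℕ-inject₁ z) (ℕ.s≤s⁻¹ hp<y)))
      (λ p<ky → s≤s (subst (toℕ (h p) ℕ.≤_) (sym (Fin.toℕ-inject₁ z))
        (ℕ.≮⇒≥ λ z<hp → ℕ.<⇒≱ p<ky (to (proj₂ (hCut p) z) z<hp))))

    k-strict : ∀ z → k (inject₁ z) <F k (suc z)
    k-strict z = ℕ.≰⇒> λ q → ℕ.<⇒≱ (ℕ.≤-refl {suc (toℕ z)})
      (subst (suc (toℕ z) ℕ.≤_) (Fin.toℕ-inject₁ z) (k-cancel (suc z) (inject₁ z) q))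

    h-surj : Surj h
    -- The preimage of `z` is `k z`: it is less than `k (z + 1)`, so `h p ≤ z`, and it is not less
    -- than `k z`, so `z ≤ h p`. Strictness also keeps it off the top, hence inside `Fin (suc a)`.
    h-surj z = p , Fin.≤-antisym
      (ℕ.s≤s⁻¹ (from (adj p (suc z)) (subst (ℕ._< toℕ (k (suc z))) (sym p≡k) (k-strict z))))
      (subst (ℕ._≤ toℕ (h p)) (Fin.toℕ-inject₁ z)
        (ℕ.≮⇒≥ λ hp<z → ℕ.<⇒≱ (to (adj p (inject₁ z)) hp<z) (ℕ.≤-reflexive (sym p≡k))))
      where
      k<top : toℕ (k (inject₁ z)) ℕ.< suc a
      k<top = ℕ.<-≤-trans (k-strict z) (ℕ.s≤s⁻¹ (Fin.toℕ<n (k (suc z))))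
      p = fromℕ< k<top
      p≡k = Fin.toℕ-fromℕ< k<top

  codual : TopSurj a b
  codual = record
    { fn = h
    ; fn-mono = λ p q p≤q → ≤-by-upper-sets (h p) (h q) λ y hq<y →
        from (adj p y) (ℕ.≤-<-trans p≤q (to (adj q y) hq<y))
    ; fn-surj = h-surj
    ; fn-topc = λ b≢0 p hp≡top → fromℕ≤⇒≡ (subst (ℕ._≤ toℕ p) (Fin.toℕ-inject₁ (fromℕ a))
        (ℕ.≮⇒≥ λ p<c → ℕ.<-irrefl (sym (Fin.toℕ-inject₁ (fromℕ b)))
          (subst (_<F coatom b) hp≡top (from (adj p (coatom b))
            (subst (p <F_) (sym (k-coatom b≢0)) p<c)))))
    }

  codual-adjoint : Adjoint (fn codual) k
  codual-adjoint = adj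

-- Products

trivialMTL : MTL
trivialMTL = record
  { Carrier = ⊤
  ; _∧_ = λ _ _ → tt ; _∨_ = λ _ _ → tt ; _⊙_ = λ _ _ → tt ; _⇒_ = λ _ _ → tt ; 𝟘 = tt ; 𝟙 = tt
  ; ∧-comm = λ _ _ → refl ; ∧-assoc = λ _ _ _ → refl ; ∨-comm = λ _ _ → refl ; ∨-assoc = λ _ _ _ → refl
  ; ∧-absorb = λ _ _ → refl ; ∨-absorb = λ _ _ → refl ; 𝟘-least = λ _ → refl ; 𝟙-greatest = λ _ → refl
  ; ⊙-comm = λ _ _ → refl ; ⊙-assoc = λ _ _ _ → refl ; ⊙-unit = λ _ → refl
  ; res→ = λ _ _ _ _ → refl ; res← = λ _ _ _ _ → refl ; prelin = λ _ _ → refl }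

infixr 2 _×ᴹ_
_×ᴹ_ : MTL → MTL → MTL
M ×ᴹ N = record
  { Carrier = M.Carrier × N.Carrier
  ; _∧_ = λ (x , y) (x' , y') → x M.∧ x' , y N.∧ y'
  ; _∨_ = λ (x , y) (x' , y') → x M.∨ x' , y N.∨ y'
  ; _⊙_ = λ (x , y) (x' , y') → x M.⊙ x' , y N.⊙ y'
  ; _⇒_ = λ (x , y) (x' , y') → (x M.⇒ x') , (y N.⇒ y')
  ; 𝟘 = M.𝟘 , N.𝟘
  ; 𝟙 = M.𝟙 , N.𝟙
  ; ∧-comm = λ _ _ → cong₂ _,_ (M.∧-comm _ _) (N.∧-comm _ _)
  ; ∧-assoc = λ _ _ _ → cong₂ _,_ (M.∧-assoc _ _ _) (N.∧-assoc _ _ _)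
  ; ∨-comm = λ _ _ → cong₂ _,_ (M.∨-comm _ _) (N.∨-comm _ _)
  ; ∨-assoc = λ _ _ _ → cong₂ _,_ (M.∨-assoc _ _ _) (N.∨-assoc _ _ _)
  ; ∧-absorb = λ _ _ → cong₂ _,_ (M.∧-absorb _ _) (N.∧-absorb _ _)
  ; ∨-absorb = λ _ _ → cong₂ _,_ (M.∨-absorb _ _) (N.∨-absorb _ _)
  ; 𝟘-least = λ _ → cong₂ _,_ (M.𝟘-least _) (N.𝟘-least _)
  ; 𝟙-greatest = λ _ → cong₂ _,_ (M.𝟙-greatest _) (N.𝟙-greatest _)
  ; ⊙-comm = λ _ _ → cong₂ _,_ (M.⊙-comm _ _) (N.⊙-comm _ _)
  ; ⊙-assoc = λ _ _ _ → cong₂ _,_ (M.⊙-assoc _ _ _) (N.⊙-assoc _ _ _)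
  ; ⊙-unit = λ _ → cong₂ _,_ (M.⊙-unit _) (N.⊙-unit _)
  ; res→ = λ _ _ _ p → cong₂ _,_ (M.res→ _ _ _ (cong proj₁ p)) (N.res→ _ _ _ (cong proj₂ p))
  ; res← = λ _ _ _ p → cong₂ _,_ (M.res← _ _ _ (cong proj₁ p)) (N.res← _ _ _ (cong proj₂ p))
  ; prelin = λ _ _ → cong₂ _,_ (M.prelin _ _) (N.prelin _ _) }
  where
  module M = MTL M
  module N = MTL N

fst-hom : ∀ M N → MTLHom (M ×ᴹ N) M
fst-hom M N = record
  { fun = proj₁ ; h∧ = λ _ _ → refl ; h∨ = λ _ _ → refl ; h⊙ = λ _ _ → refl ; h⇒ = λ _ _ → refl
  ; h𝟘 = refl ; h𝟙 = refl }

snd-hom : ∀ M N → MTLHom (M ×ᴹ N) N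
snd-hom M N = record
  { fun = proj₂ ; h∧ = λ _ _ → refl ; h∨ = λ _ _ → refl ; h⊙ = λ _ _ → refl ; h⇒ = λ _ _ → refl
  ; h𝟘 = refl ; h𝟙 = refl }

pair-hom : ∀ {A M N} → MTLHom A M → MTLHom A N → MTLHom A (M ×ᴹ N)
pair-hom k l = record
  { fun = λ x → fun k x , fun l x
  ; h∧ = λ x y → cong₂ _,_ (h∧ k x y) (h∧ l x y)
  ; h∨ = λ x y → cong₂ _,_ (h∨ k x y) (h∨ l x y)
  ; h⊙ = λ x y → cong₂ _,_ (h⊙ k x y) (h⊙ l x y)
  ; h⇒ = λ x y → cong₂ _,_ (h⇒ k x y) (h⇒ l x y)
  ; h𝟘 = cong₂ _,_ (h𝟘 k) (h𝟘 l)
  ; h𝟙 = cong₂ _,_ (h𝟙 k) (h𝟙 l) }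

-- Nested pairs instead of functions, so that equality is coordinatewise by `∏-ext` without function
-- extensionality. The empty product is the trivial algebra, dual to the empty multiset.
∏ : ∀ m → (Fin m → MTL) → MTL
∏ zero M = trivialMTL
∏ (suc m) M = M zero ×ᴹ ∏ m (M ∘ suc)

π : ∀ {m} (M : Fin m → MTL) i → MTLHom (∏ m M) (M i)
π M zero = fst-hom (M zero) (∏ _ (M ∘ suc))
π M (suc i) = MTLHom-comp (π (M ∘ suc) i) (snd-hom (M zero) (∏ _ (M ∘ suc)))

tuple : ∀ {m A} (M : Fin m → MTL) → (∀ i → MTLHom A (M i)) → MTLHom A (∏ m M)
tuple {zero} M k = record
  { fun = λ _ → tt ; h∧ = λ _ _ → refl ; h∨ = λ _ _ → refl ; h⊙ = λ _ _ → refl ; h⇒ = λ _ _ → refl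
  ; h𝟘 = refl ; h𝟙 = refl }
tuple {suc m} M k = pair-hom (k zero) (tuple (M ∘ suc) (k ∘ suc))

π-tuple : ∀ {m A} (M : Fin m → MTL) (k : ∀ i → MTLHom A (M i)) i x → fun (π M i) (fun (tuple M k) x) ≡ fun (k i) x
π-tuple M k zero x = refl
π-tuple M k (suc i) x = π-tuple (M ∘ suc) (k ∘ suc) i x

tabulate∏ : ∀ {m} (M : Fin m → MTL) → (∀ i → Carrier (M i)) → Carrier (∏ m M)
tabulate∏ {zero} M u = tt
tabulate∏ {suc m} M u = u zero , tabulate∏ (M ∘ suc) (u ∘ suc)

π-tabulate∏ : ∀ {m} (M : Fin m → MTL) (u : ∀ i → Carrier (M i)) i → fun (π M i) (tabulate∏ M u) ≡ u i
π-tabulate∏ M u zero = refl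
π-tabulate∏ M u (suc i) = π-tabulate∏ (M ∘ suc) (u ∘ suc) i

∏-ext : ∀ {m} (M : Fin m → MTL) {x y : Carrier (∏ m M)} → (∀ i → fun (π M i) x ≡ fun (π M i) y) → x ≡ y
∏-ext {zero} M p = refl
∏-ext {suc m} M p = cong₂ _,_ (p zero) (∏-ext (M ∘ suc) (p ∘ suc))

∏-finite : ∀ {m} (M : Fin m → MTL) → (∀ i → Σ ℕ λ k → Carrier (M i) ↔ Fin k) → Σ ℕ λ k → Carrier (∏ m M) ↔ Fin k
∏-finite {zero} M fin = 1 , ↔-sym Fin.1↔⊤
∏-finite {suc m} M fin with fin zero | ∏-finite (M ∘ suc) (fin ∘ suc)
... | k , e | l , e' = k ℕ.* l , ↔-trans (e ×-↔ e') (↔-sym Fin.*↔×)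

hom-⟦⟧ : ∀ {A B} (k : MTLHom A B) t v → fun k (⟦ t ⟧ A v) ≡ ⟦ t ⟧ B (fun k ∘ v)
hom-⟦⟧ k (var i) v = refl
hom-⟦⟧ k t𝟘 v = h𝟘 k
hom-⟦⟧ k t𝟙 v = h𝟙 k
hom-⟦⟧ {B = B} k (s t∧ t) v = trans (h∧ k _ _) (cong₂ (_∧_ B) (hom-⟦⟧ k s v) (hom-⟦⟧ k t v))
hom-⟦⟧ {B = B} k (s t∨ t) v = trans (h∨ k _ _) (cong₂ (_∨_ B) (hom-⟦⟧ k s v) (hom-⟦⟧ k t v))
hom-⟦⟧ {B = B} k (s t⊙ t) v = trans (h⊙ k _ _) (cong₂ (_⊙_ B) (hom-⟦⟧ k s v) (hom-⟦⟧ k t v))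
hom-⟦⟧ {B = B} k (s t⇒ t) v = trans (h⇒ k _ _) (cong₂ (_⇒_ B) (hom-⟦⟧ k s v) (hom-⟦⟧ k t v))

∏-isDP : ∀ {m} (M : Fin m → MTL) → (∀ i → IsDPChain (M i)) → IsDP (∏ m M)
∏-isDP M dp s t valid v = ∏-ext M λ i →
  trans (hom-⟦⟧ (π M i) s v) (trans (valid (M i) (dp i) (fun (π M i) ∘ v)) (sym (hom-⟦⟧ (π M i) t v)))

-- The contravariant functor to finite DP-algebras

Chains : (A : MCObj) → Fin (n A) → MTL
Chains A i = drasticChain (len A i)

dual₀ : MCObj → FinDP
dual₀ A = record
  { alg = ∏ (n A) (Chains A)
  ; isDP = ∏-isDP (Chains A) (λ i → drasticChain-isDPChain (len A i))
  ; finite = ∏-finite (Chains A) (λ i → suc (suc (len A i)) , ↔-refl) }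

dualComp : ∀ {a} B → MCComp a B → MTLHom (∏ (n B) (Chains B)) (drasticChain a)
dualComp B (j , h) = MTLHom-comp (dual h) (π (Chains B) j)

dual₁ : ∀ {A B} → MCTHom A B → MTLHom (alg (dual₀ B)) (alg (dual₀ A))
dual₁ {A} {B} h = tuple (Chains A) λ i → dualComp B (idx h i , componentMC h i)

π-dual₁ : ∀ {A B} (h : MCTHom A B) i x →
          fun (π (Chains A) i) (fun (dual₁ h) x) ≡ fun (dualComp B (idx h i , componentMC h i)) x
π-dual₁ {A} {B} h = π-tuple (Chains A) λ i → dualComp B (idx h i , componentMC h i)

dual-ext : ∀ {a b} (h h' : TopSurj a b) → (∀ x → fn h x ≡ fn h' x) → ∀ y → fun (dual h) y ≡ fun (dual h') y
dual-ext h h' = adjoint-unique (dualMap-adjoint h) (dualMap-adjoint h')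

dualComp-resp : ∀ {a} B (c d : MCComp a B) → MCCompEq B c d → ∀ x → fun (dualComp B c) x ≡ fun (dualComp B d) x
dualComp-resp B (j , h) (j' , h') p x with cong proj₁ (p zero)
... | refl = dual-ext h h' (MCCompEq⇒≡ B {h = h} {h'} p) (fun (π (Chains B) j) x)

DPfin-isCategory : IsCategory (op DPfin)
DPfin-isCategory = record
  { ≈-refl = λ _ → refl
  ; ≈-sym = λ p x → sym (p x)
  ; ≈-trans = λ p q x → trans (p x) (q x)
  ; ⊚-cong = λ {_} {_} {_} {_} {_} {k} {k'} p q x → trans (cong (fun k) (p x)) (q _)
  ; assoc = λ _ _ _ _ → refl
  ; idˡ = λ _ _ → refl
  ; idʳ = λ _ _ → refl }

dual-id : ∀ {a} (h : TopSurj a a) → (∀ x → fn h x ≡ x) → ∀ y → fun (dual h) y ≡ y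
dual-id h = adjoint-unique (dualMap-adjoint h) (λ p y → mk⇔ (λ q → q) (λ q → q))

dual-comp : ∀ {a b c} (h : TopSurj a b) (k : TopSurj b c) (l : TopSurj a c) →
            (∀ x → fn l x ≡ fn k (fn h x)) → ∀ y → fun (dual l) y ≡ fun (dual h) (fun (dual k) y)
dual-comp h k l = adjoint-unique (dualMap-adjoint l) λ p y →
  mk⇔ (to (dualMap-adjoint h p (dualMap k y)) ∘ to (dualMap-adjoint k (fn h p) y))
      (from (dualMap-adjoint k (fn h p) y) ∘ from (dualMap-adjoint h p (dualMap k y)))

dualFunctor : Functor MCT (op DPfin)
dualFunctor = record
  { F₀ = dual₀
  ; F₁ = dual₁
  ; resp = λ {A} {B} {h} {k} p x → ∏-ext (Chains A) λ i →
      trans (π-dual₁ h i x)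
        (trans (dualComp-resp B (idx h i , componentMC h i) (idx k i , componentMC k i) (p i) x)
          (sym (π-dual₁ k i x)))
  ; pres-id = λ {A} x → ∏-ext (Chains A) λ i →
      trans (π-dual₁ (MCT-id {A}) i x) (dual-id (componentMC {A} MCT-id i) (λ _ → refl) _)
  ; pres-∘ = λ {A} {B} {C} k h x → ∏-ext (Chains A) λ i →
      trans (π-dual₁ (MCT-comp k h) i x)
        (trans (dual-comp (componentMC h i) (componentMC k (idx h i)) (componentMC (MCT-comp k h) i) (λ _ → refl)
                 (fun (π (Chains C) (idx k (idx h i))) x))
          (sym (trans (π-dual₁ h i (fun (dual₁ k) x))
                      (cong (fun (dual (componentMC h i))) (π-dual₁ k (idx h i) x)))))
  }

-- Full faithfulness

module _ {m} (M : Fin m → MTL) (j : Fin m) (y : Carrier (M j)) where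
  private
    entry : ∀ l → Dec (j ≡ l) → Carrier (M l)
    entry l (yes refl) = y
    entry l (no _) = 𝟘 (M l)

    entry-hit : ∀ d → entry j d ≡ y
    entry-hit (yes refl) = refl
    entry-hit (no p) = ⊥-elim (p refl)

    entry-miss : ∀ {l} → j ≢ l → ∀ d → entry l d ≡ 𝟘 (M l)
    entry-miss p (yes q) = ⊥-elim (p q)
    entry-miss p (no _) = refl

  single : Carrier (∏ m M)
  single = tabulate∏ M λ l → entry l (j Fin.≟ l)

  π-single : fun (π M j) single ≡ y
  π-single = trans (π-tabulate∏ M _ j) (entry-hit (j Fin.≟ j))

  π-single-≢ : ∀ {l} → j ≢ l → fun (π M l) single ≡ 𝟘 (M l)
  π-single-≢ {l} p = trans (π-tabulate∏ M _ l) (entry-miss p (j Fin.≟ l))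

-- Elements supported at one coordinate are enough as tests. If `j` and `j'` differ, the element
-- that is `1` at `j` and `0` elsewhere goes to `1` under one map and to `0` under the other.
dualComp-reflect : ∀ {a} B (c d : MCComp a B) → (∀ x → fun (dualComp B c) x ≡ fun (dualComp B d) x) → MCCompEq B c d
dualComp-reflect {a} B (j , h) (j' , h') p with j Fin.≟ j'
... | yes refl = λ x → cong (j ,_) (adjoint-injective (dualMap-adjoint h) (dualMap-adjoint h') duals-agree x)
  where
  duals-agree : ∀ y → fun (dual h) y ≡ fun (dual h') y
  duals-agree y = subst (λ z → fun (dual h) z ≡ fun (dual h') z) (π-single (Chains B) j y)
    (p (single (Chains B) j y))
... | no j≢j' = ⊥-elim (absurd (trans (sym at-j) (trans (p δ) at-j′)))
  where
  δ = single (Chains B) j (𝟙 (Chains B j))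
  at-j : fun (dualComp B (j , h)) δ ≡ topD a
  at-j = trans (cong (fun (dual h)) (π-single (Chains B) j _)) (h𝟙 (dual h))
  at-j′ : fun (dualComp B (j' , h')) δ ≡ zero
  at-j′ = trans (cong (fun (dual h')) (π-single-≢ (Chains B) j _ j≢j')) (h𝟘 (dual h'))
  absurd : topD a ≢ zero
  absurd ()

swap-hom : ∀ M N → MTLHom (M ×ᴹ N) (N ×ᴹ M)
swap-hom M N = pair-hom (snd-hom M N) (fst-hom M N)

-- Since `(1 , 0)` goes to `1`, meeting with it does not change the value of `H`, while it replaces
-- the second coordinate by `0`.
hom-on-first : ∀ {M N K} (H : MTLHom (M ×ᴹ N) K) → fun H (𝟙 M , 𝟘 N) ≡ 𝟙 K →
               Σ (MTLHom M K) λ k → ∀ x y → fun H (x , y) ≡ fun k x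
hom-on-first {M} {N} {K} H H10≡1 = k , ignores-second
  where
  ignores-second : ∀ x y → fun H (x , y) ≡ fun H (x , 𝟘 N)
  ignores-second x y = trans (sym (𝟙-greatest K (fun H (x , y))))
    (trans (cong (_∧_ K (fun H (x , y))) (sym H10≡1))
    (trans (sym (h∧ H (x , y) (𝟙 M , 𝟘 N)))
           (cong (fun H) (cong₂ _,_ (𝟙-greatest M x) (trans (∧-comm N y (𝟘 N)) (𝟘-least N y))))))
  k : MTLHom M K
  k = record
    { fun = λ x → fun H (x , 𝟘 N)
    ; h∧ = λ x y → trans (sym (ignores-second _ _)) (h∧ H (x , 𝟘 N) (y , 𝟘 N))
    ; h∨ = λ x y → trans (sym (ignores-second _ _)) (h∨ H (x , 𝟘 N) (y , 𝟘 N))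
    ; h⊙ = λ x y → trans (sym (ignores-second _ _)) (h⊙ H (x , 𝟘 N) (y , 𝟘 N))
    ; h⇒ = λ x y → trans (sym (ignores-second _ _)) (h⇒ H (x , 𝟘 N) (y , 𝟘 N))
    ; h𝟘 = h𝟘 H
    ; h𝟙 = H10≡1 }

chain-∨-prime : ∀ {K} → IsDPChain K → ∀ x y → _∨_ K x y ≡ 𝟙 K → x ≡ 𝟙 K ⊎ y ≡ 𝟙 K
chain-∨-prime {K} dp x y p with IsDPChain.total dp x y
... | inj₁ x≤y = inj₂ (trans (sym (MTLProperties.≼⇒⊔ K x≤y)) p)
... | inj₂ y≤x = inj₁ (trans (sym (MTLProperties.≼⇒⊔ K y≤x)) (trans (∨-comm K y x) p))

-- The join of `(1 , 0)` and `(0 , 1)` is `1`, and `1` is join-prime in a chain, so one of them goes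
-- to `1` and the other factor drops out. Nontriviality of `K` excludes the empty product.
∏-hom-factors : ∀ {m} (M : Fin m → MTL) {K} → IsDPChain K → 𝟙 K ≢ 𝟘 K → (H : MTLHom (∏ m M) K) →
                Σ (Fin m) λ j → Σ (MTLHom (M j) K) λ k → ∀ x → fun H x ≡ fun k (fun (π M j) x)
∏-hom-factors {zero} M dp 1≢0 H = ⊥-elim (1≢0 (trans (sym (h𝟙 H)) (h𝟘 H)))
∏-hom-factors {suc m} M {K} dp 1≢0 H
  with chain-∨-prime dp (fun H (𝟙 (M zero) , 𝟘 N)) (fun H (𝟘 (M zero) , 𝟙 N))
         (trans (sym (h∨ H _ _)) (trans (cong (fun H) (cong₂ _,_ 1∨0 0∨1)) (h𝟙 H)))
  where
  N = ∏ m (M ∘ suc)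
  0∨1 : _∨_ N (𝟘 N) (𝟙 N) ≡ 𝟙 N
  0∨1 = MTLProperties.≼⇒⊔ N (𝟘-least N (𝟙 N))
  1∨0 : _∨_ (M zero) (𝟙 (M zero)) (𝟘 (M zero)) ≡ 𝟙 (M zero)
  1∨0 = trans (∨-comm (M zero) _ _) (MTLProperties.≼⇒⊔ (M zero) (𝟘-least (M zero) (𝟙 (M zero))))
... | inj₁ p with hom-on-first {M zero} {∏ m (M ∘ suc)} H p
...   | k , eq = zero , k , λ (x , y) → eq x y
∏-hom-factors {suc m} M {K} dp 1≢0 H | inj₂ p
  with hom-on-first {∏ m (M ∘ suc)} {M zero} (MTLHom-comp H (swap-hom (∏ m (M ∘ suc)) (M zero))) p
...   | k , eq with ∏-hom-factors (M ∘ suc) dp 1≢0 k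
...     | j , l , eq' = suc j , l , λ (x , y) → trans (eq y x) (eq' y)

dualFunctor-ff : FullyFaithful dualFunctor
dualFunctor-ff = record
  { lift = λ {A} {B} H → record
      { idx = λ i → proj₁ (factor {A} {B} H i)
      ; map = λ i → fn (comp {A} {B} H i)
      ; mono = λ i → fn-mono (comp {A} {B} H i)
      ; surj = λ i → fn-surj (comp {A} {B} H i)
      ; topc = λ i → fn-topc (comp {A} {B} H i) }
  ; F₁-lift = λ {A} {B} H x → ∏-ext (Chains A) λ i →
      let (j , k , eq) = factor {A} {B} H i in
      trans (π-tuple (Chains A) _ i x)
        (trans (adjoint-unique (dualMap-adjoint (comp {A} {B} H i)) (codual-adjoint (hom⇒embedding k))
                  (λ _ → refl) (fun (π (Chains B) j) x))
               (sym (eq x)))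
  ; faithful = λ {A} {B} {h} {k} p i →
      dualComp-reflect B (idx h i , componentMC h i) (idx k i , componentMC k i) λ x →
        trans (sym (π-dual₁ h i x)) (trans (cong (fun (π (Chains A) i)) (p x)) (π-dual₁ k i x))
  }
  where
  factor : ∀ {A B} (H : MTLHom (alg (dual₀ B)) (alg (dual₀ A))) i →
           Σ (Fin (n B)) λ j → Σ (MTLHom (Chains B j) (Chains A i)) λ k →
             ∀ x → fun (π (Chains A) i) (fun H x) ≡ fun k (fun (π (Chains B) j) x)
  factor {A} {B} H i = ∏-hom-factors (Chains B) (drasticChain-isDPChain (len A i)) (λ ())
    (MTLHom-comp (π (Chains A) i) H)
  comp : ∀ {A B} (H : MTLHom (alg (dual₀ B)) (alg (dual₀ A))) i →
         TopSurj (len A i) (len B (proj₁ (factor {A} {B} H i)))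
  comp {A} {B} H i = codual (hom⇒embedding (proj₁ (proj₂ (factor {A} {B} H i))))

-- Equations of DP-algebras

module _ {C : MTL} (dp : IsDPChain C) where
  open MTLProperties C
  open IsDPChain dp
  private module C = MTL C

  -- The two answers total x y and total y x are the same function value when x ≡ y, so
  -- different answers refute x ≡ y and equal ones prove it.
  chain-≟ : ∀ x y → Dec (x ≡ y)
  chain-≟ x y with total x y in p | total y x in q
  ... | inj₁ x≤y | inj₁ y≤x = yes (≼-antisym x≤y y≤x)
  ... | inj₂ y≤x | inj₂ x≤y = yes (≼-antisym x≤y y≤x)
  ... | inj₁ _   | inj₂ _   = no λ { refl → case trans (sym p) q of λ () }
  ... | inj₂ _   | inj₁ _   = no λ { refl → case trans (sym q) p of λ () }

  chain-square : ∀ c → c · c ≡ 1# ⊎ c · c ≡ 0#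
  chain-square c with chain-≟ c 1#
  ... | yes refl = inj₁ (C.⊙-unit 1#)
  ... | no c≢1   = inj₂ (drastic c c c≢1 c≢1)

  chain-splits : ∀ e x y → (e · ((x ↝ y) · (x ↝ y))) ⊔ (e · ((y ↝ x) · (y ↝ x))) ≡ e
  chain-splits e x y with total x y
  ... | inj₁ x≤y rewrite ≼⇒↝≡1# x≤y | C.⊙-unit 1# | C.⊙-unit e = trans (C.∨-comm e _) (≼⇒⊔ (·-lower₁ e _))
  ... | inj₂ y≤x rewrite ≼⇒↝≡1# y≤x | C.⊙-unit 1# | C.⊙-unit e = ≼⇒⊔ (·-lower₁ e _)

  chain-square-complement : ∀ c → (c · c) ⊔ ((c · c) ↝ 0#) ≡ 1#
  chain-square-complement c with chain-square c
  ... | inj₁ p rewrite p = 1#≼⇒≡ (C.∧-absorb 1# _)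
  ... | inj₂ p rewrite p = trans (cong (0# ⊔_) (≼⇒↝≡1# ≼-refl)) (≼⇒⊔ 0#-min)

  chain-complement-idem : ∀ c → ((c · c) ↝ 0#) · ((c · c) ↝ 0#) ≡ ((c · c) ↝ 0#)
  chain-complement-idem c with chain-square c
  ... | inj₁ p rewrite p | 1#-↝ 0# = 0#-zeroˡ 0#
  ... | inj₂ p rewrite p | ≼⇒↝≡1# (≼-refl {0#}) = C.⊙-unit 1#

  chain-squares-idem : ∀ b c → ((b · b) · (c · c)) · ((b · b) · (c · c)) ≡ (b · b) · (c · c)
  chain-squares-idem b c with chain-square b | chain-square c
  ... | inj₁ p | inj₁ q rewrite p | q | C.⊙-unit 1# = C.⊙-unit 1#
  ... | inj₂ p | _      rewrite p | 0#-zeroˡ (c · c) = 0#-zeroˡ 0#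
  ... | inj₁ p | inj₂ q rewrite p | q | 1#-unitˡ 0# = 0#-zeroˡ 0#

-- Only identities pass from chains to `A`, not implications. Hypotheses of idempotence are
-- therefore built into the terms as squares, and `splits` carries an arbitrary factor `e` instead
-- of assuming anything about it.
module DPEquations {A : MTL} (dp : IsDP A) where
  open MTLProperties A

  private
    v₀ v₁ v₂ sq₀ sq₁ : Term
    v₀ = var 0
    v₁ = var 1
    v₂ = var 2
    sq₀ = v₀ t⊙ v₀
    sq₁ = v₁ t⊙ v₁

    valuation : X → X → X → ℕ → X
    valuation x y z 0 = x
    valuation x y z 1 = y
    valuation x y z _ = z

  splits : ∀ e x y → (e · ((x ↝ y) · (x ↝ y))) ⊔ (e · ((y ↝ x) · (y ↝ x))) ≡ e
  splits e x y =
    dp ((v₀ t⊙ ((v₁ t⇒ v₂) t⊙ (v₁ t⇒ v₂))) t∨ (v₀ t⊙ ((v₂ t⇒ v₁) t⊙ (v₂ t⇒ v₁)))) v₀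
      (λ C dpC v → chain-splits dpC (v 0) (v 1) (v 2)) (valuation e x y)

  square-complement : ∀ c → (c · c) ⊔ ((c · c) ↝ 0#) ≡ 1#
  square-complement c = dp (sq₀ t∨ (sq₀ t⇒ t𝟘)) t𝟙
    (λ C dpC v → chain-square-complement dpC (v 0)) (valuation c c c)

  complement-idem : ∀ c → ((c · c) ↝ 0#) · ((c · c) ↝ 0#) ≡ ((c · c) ↝ 0#)
  complement-idem c = dp ((sq₀ t⇒ t𝟘) t⊙ (sq₀ t⇒ t𝟘)) (sq₀ t⇒ t𝟘)
    (λ C dpC v → chain-complement-idem dpC (v 0)) (valuation c c c)

  squares-idem : ∀ b c → ((b · b) · (c · c)) · ((b · b) · (c · c)) ≡ (b · b) · (c · c)
  squares-idem b c = dp ((sq₀ t⊙ sq₁) t⊙ (sq₀ t⊙ sq₁)) (sq₀ t⊙ sq₁)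
    (λ C dpC v → chain-squares-idem dpC (v 0) (v 1)) (valuation b c c)

-- Finite enumerations and rankings

record Enumeration {k} (P : Fin k → Set) : Set where
  field
    count     : ℕ
    item      : Fin count → Fin k
    item-sat  : ∀ i → P (item i)
    item-inj  : ∀ {i j} → item i ≡ item j → i ≡ j
    item-surj : ∀ x → P x → ∃ λ i → item i ≡ x

enumerate : ∀ {k} {P : Fin k → Set} → (∀ x → Dec (P x)) → Enumeration P
enumerate {zero} P? = record
  { count = 0 ; item = λ () ; item-sat = λ () ; item-inj = λ {} ; item-surj = λ () }
enumerate {suc k} P? with enumerate (P? ∘ suc) | P? zero
... | E | no ¬p = record
  { count = count ; item = suc ∘ item ; item-sat = item-sat ; item-inj = item-inj ∘ Fin.suc-injective
  ; item-surj = λ { zero p → ⊥-elim (¬p p)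
                  ; (suc x) p → let (i , q) = item-surj x p in i , cong suc q } }
  where open Enumeration E
... | E | yes p = record
  { count = suc count
  ; item = λ { zero → zero ; (suc i) → suc (item i) }
  ; item-sat = λ { zero → p ; (suc i) → item-sat i }
  ; item-inj = λ { {zero} {zero} _ → refl ; {suc i} {suc j} q → cong suc (item-inj (Fin.suc-injective q)) }
  ; item-surj = λ { zero _ → zero , refl
                  ; (suc x) p → let (i , q) = item-surj x p in suc i , cong suc q } }
  where open Enumeration E

-- `R` is presented as the pullback of the order of `Fin N` along a surjection, so `Fin N` serves as
-- the quotient of a total preorder by mutual comparability, without quotient types.
record Ranking {X : Set} (R : X → X → Set) (N : ℕ) : Set where
  field
    rank        : X → Fin N
    rep         : Fin N → X
    rank-rep    : ∀ c → rank (rep c) ≡ c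
    rank-mono   : ∀ {x y} → R x y → rank x ≤F rank y
    rank-cancel : ∀ {x y} → rank x ≤F rank y → R x y

punchIn≤⇔ : ∀ {m} (p : Fin (suc m)) c → punchIn p c ≤F p ⇔ c <F p
punchIn≤⇔ zero c = mk⇔ (λ ()) (λ ())
punchIn≤⇔ (suc p) zero = mk⇔ (λ _ → s≤s z≤n) (λ _ → z≤n)
punchIn≤⇔ (suc p) (suc c) = mk⇔ (λ { (s≤s q) → s≤s (to (punchIn≤⇔ p c) q) })
                                         (λ { (s≤s q) → s≤s (from (punchIn≤⇔ p c) q) })

≤punchIn⇔ : ∀ {m} (p : Fin (suc m)) c → p ≤F punchIn p c ⇔ p ≤F c
≤punchIn⇔ zero c = mk⇔ (λ _ → z≤n) (λ _ → z≤n)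
≤punchIn⇔ (suc p) zero = mk⇔ (λ ()) (λ ())
≤punchIn⇔ (suc p) (suc c) = mk⇔ (λ { (s≤s q) → s≤s (to (≤punchIn⇔ p c) q) })
                                         (λ { (s≤s q) → s≤s (from (≤punchIn⇔ p c) q) })

module _ {X : Set} {R : X → X → Set} where

  -- Insertion: `u zero` joins the class of an equivalent later element or, if there is none,
  -- becomes a new class. Its position `p` is the number of old classes below it, and `punchIn p`
  -- shifts the rest.
  rank-Fin : (R-refl : ∀ {x} → R x x) (R-trans : ∀ {x y z} → R x y → R y z → R x z)
             (R-total : ∀ x y → R x y ⊎ R y x) (R? : ∀ x y → Dec (R x y)) →
             ∀ {k} (u : Fin k → X) → Σ ℕ (Ranking (λ i j → R (u i) (u j)))
  rank-Fin R-refl R-trans R-total R? = go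
    where
    go : ∀ {k} (u : Fin k → X) → Σ ℕ (Ranking (λ i j → R (u i) (u j)))
    go {zero} u = 0 , record
      { rank = λ () ; rep = λ () ; rank-rep = λ () ; rank-mono = λ {} ; rank-cancel = λ {} }
    go {suc k} u with go (u ∘ suc)
    ... | N , r with Fin.any? (λ j → R? (u zero) (u (suc j)) ×-dec R? (u (suc j)) (u zero))
    ...   | yes (j , 0≤j , j≤0) = N , record
      { rank = rank′
      ; rep = suc ∘ rep
      ; rank-rep = rank-rep
      ; rank-mono = λ {x} {y} → mono′ x y
      ; rank-cancel = λ {x} {y} → cancel′ x y }
      where
      open Ranking r
      rank′ : Fin (suc k) → Fin N
      rank′ zero = rank j
      rank′ (suc i) = rank i
      mono′ : ∀ x y → R (u x) (u y) → rank′ x ≤F rank′ y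
      mono′ zero zero _ = Fin.≤-refl
      mono′ zero (suc y) p = rank-mono (R-trans j≤0 p)
      mono′ (suc x) zero p = rank-mono (R-trans p 0≤j)
      mono′ (suc x) (suc y) p = rank-mono p
      cancel′ : ∀ x y → rank′ x ≤F rank′ y → R (u x) (u y)
      cancel′ zero zero _ = R-refl
      cancel′ zero (suc y) p = R-trans 0≤j (rank-cancel p)
      cancel′ (suc x) zero p = R-trans (rank-cancel p) j≤0
      cancel′ (suc x) (suc y) p = rank-cancel p
    ...   | no new = suc N , record
      { rank = rank′
      ; rep = rep′
      ; rank-rep = rank-rep′
      ; rank-mono = λ {x} {y} → mono′ x y
      ; rank-cancel = λ {x} {y} → cancel′ x y }
      where
      open Ranking r
      below : ∀ c → Dec (R (u (suc (rep c))) (u zero))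
      below c = R? (u (suc (rep c))) (u zero)
      rep-mono : ∀ c d → c ≤F d → R (u (suc (rep c))) (u (suc (rep d)))
      rep-mono c d c≤d = rank-cancel (subst₂ _≤F_ (sym (rank-rep c)) (sym (rank-rep d)) c≤d)
      position = cut below (λ c d c≤d → R-trans (rep-mono c d c≤d))
      p = proj₁ position
      to-rep : ∀ i → R (u (suc i)) (u (suc (rep (rank i))))
      to-rep i = rank-cancel (Fin.≤-reflexive (sym (rank-rep (rank i))))
      from-rep : ∀ i → R (u (suc (rep (rank i)))) (u (suc i))
      from-rep i = rank-cancel (Fin.≤-reflexive (rank-rep (rank i)))
      <p⇒R : ∀ i → rank i <F p → R (u (suc i)) (u zero)
      <p⇒R i q = R-trans (to-rep i) (to (proj₂ position (rank i)) q)
      R⇒<p : ∀ i → R (u (suc i)) (u zero) → rank i <F p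
      R⇒<p i q = from (proj₂ position (rank i)) (R-trans (from-rep i) q)
      rank′ : Fin (suc k) → Fin (suc N)
      rank′ zero = p
      rank′ (suc i) = punchIn p (rank i)
      rep-dec : ∀ c → Dec (p ≡ c) → Fin (suc k)
      rep-dec c (yes _) = zero
      rep-dec c (no p≢c) = suc (rep (punchOut p≢c))
      rank-rep-dec : ∀ c d → rank′ (rep-dec c d) ≡ c
      rank-rep-dec c (yes q) = q
      rank-rep-dec c (no p≢c) = trans (cong (punchIn p) (rank-rep _)) (Fin.punchIn-punchOut p≢c)
      rep′ : Fin (suc N) → Fin (suc k)
      rep′ c = rep-dec c (p Fin.≟ c)
      rank-rep′ : ∀ c → rank′ (rep′ c) ≡ c
      rank-rep′ c = rank-rep-dec c (p Fin.≟ c)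
      mono′ : ∀ x y → R (u x) (u y) → rank′ x ≤F rank′ y
      mono′ zero zero _ = Fin.≤-refl
      -- A rank below `p` would make this element equivalent to `u zero`, which `new` excludes.
      mono′ zero (suc y) q = from (≤punchIn⇔ p (rank y))
        (ℕ.≮⇒≥ λ y<p → new (y , q , <p⇒R y y<p))
      mono′ (suc x) zero q = from (punchIn≤⇔ p (rank x)) (R⇒<p x q)
      mono′ (suc x) (suc y) q = Fin.punchIn-mono-≤ p _ _ (rank-mono q)
      cancel′ : ∀ x y → rank′ x ≤F rank′ y → R (u x) (u y)
      cancel′ zero zero _ = R-refl
      cancel′ zero (suc y) q with R-total (u zero) (u (suc y))
      ... | inj₁ 0≤y = 0≤y
      ... | inj₂ y≤0 = ⊥-elim (ℕ.<⇒≱ (R⇒<p y y≤0) (to (≤punchIn⇔ p (rank y)) q))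
      cancel′ (suc x) zero q = <p⇒R x (to (punchIn≤⇔ p (rank x)) q)
      cancel′ (suc x) (suc y) q = rank-cancel (Fin.punchIn-cancel-≤ p _ _ q)

  ranking-pullback : ∀ {k N} (e : X ↔ Fin k) →
    Ranking (λ i j → R (Function.Inverse.from e i) (Function.Inverse.from e j)) N → Ranking R N
  ranking-pullback e r = record
    { rank = rank ∘ e.to
    ; rep = e.from ∘ rep
    ; rank-rep = λ c → trans (cong rank (e.strictlyInverseˡ (rep c))) (rank-rep c)
    ; rank-mono = λ p → rank-mono (subst₂ R (sym (e.strictlyInverseʳ _)) (sym (e.strictlyInverseʳ _)) p)
    ; rank-cancel = λ p → subst₂ R (e.strictlyInverseʳ _) (e.strictlyInverseʳ _) (rank-cancel p) }
    where
    open Ranking r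
    module e = Function.Inverse e

  two-ranks : ∀ {x y} → ¬ R x y → Σ ℕ (Ranking R) → Σ ℕ (λ m → Ranking R (suc (suc m)))
  two-ranks {x} ¬xy (0 , r) with Ranking.rank r x
  ... | ()
  two-ranks {x} {y} ¬xy (1 , r) = ⊥-elim (¬xy (rank-cancel (Fin.≤-reflexive (singleton-unique refl (rank x) (rank y)))))
    where open Ranking r
  two-ranks ¬xy (suc (suc m) , r) = m , r

-- Decomposition of finite DP-algebras

inverse-hom : ∀ {A B} (H : MTLHom A B) → (∀ {x y} → fun H x ≡ fun H y → x ≡ y) →
              (k : Carrier B → Carrier A) → (∀ y → fun H (k y) ≡ y) → MTLHom B A
inverse-hom {A} {B} H inj k Hk = record
  { fun = k
  ; h∧ = λ x y → inj (trans (Hk _) (sym (trans (h∧ H _ _) (cong₂ (_∧_ B) (Hk x) (Hk y)))))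
  ; h∨ = λ x y → inj (trans (Hk _) (sym (trans (h∨ H _ _) (cong₂ (_∨_ B) (Hk x) (Hk y)))))
  ; h⊙ = λ x y → inj (trans (Hk _) (sym (trans (h⊙ H _ _) (cong₂ (_⊙_ B) (Hk x) (Hk y)))))
  ; h⇒ = λ x y → inj (trans (Hk _) (sym (trans (h⇒ H _ _) (cong₂ (_⇒_ B) (Hk x) (Hk y)))))
  ; h𝟘 = inj (trans (Hk _) (sym (h𝟘 H)))
  ; h𝟙 = inj (trans (Hk _) (sym (h𝟙 H))) }

module Decomposition (A : FinDP) where
  open MTLProperties (alg A)
  open DPEquations (isDP A)
  private
    module M = MTL (alg A)
    K = proj₁ (finite A)
    module enum = Function.Inverse (proj₂ (finite A))

    ≟ₐ : (x y : X) → Dec (x ≡ y)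
    ≟ₐ x y = map′ (λ p → trans (sym (enum.strictlyInverseʳ x)) (trans (cong enum.from p) (enum.strictlyInverseʳ y)))
                  (cong enum.to) (enum.to x Fin.≟ enum.to y)

    ∀-enum : {P : X → Set} → (∀ i → P (enum.from i)) → ∀ x → P x
    ∀-enum {P} p x = subst P (enum.strictlyInverseʳ x) (p (enum.to x))

  Splits : X → X → Set
  Splits e c = e · (c · c) ≡ e ⊎ e · (c · c) ≡ 0#

  -- The atoms of the Boolean algebra of squares, expressed by a dichotomy: every square either
  -- absorbs `e` or is disjoint from it. Quantifying over squares makes this a finite check.
  record Atom (e : X) : Set where
    constructor atom
    field
      e-idem   : e · e ≡ e
      e≢0      : e ≢ 0#
      e-splits : ∀ c → Splits e c

  atom? : ∀ e → Dec (Atom e)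
  atom? e = map′ (λ (p , q , r) → atom p q (∀-enum r)) (λ (atom p q r) → p , q , r ∘ enum.from)
    (≟ₐ (e · e) e ×-dec ¬? (≟ₐ e 0#) ×-dec
     Fin.all? λ i → let c = enum.from i in ≟ₐ (e · (c · c)) e ⊎-dec ≟ₐ (e · (c · c)) 0#)

  -- Go through the list and meet `b` with each square unless the result is `0`. Both outcomes
  -- survive further shrinking, so one pass over an enumeration of the algebra ends at an atom.
  refine : ∀ {l} (c : Fin l → X) b → b · b ≡ b → b ≢ 0# →
           ∃ λ e → (e · e ≡ e) × (e ≢ 0#) × (e ≼ b) × (∀ i → Splits e (c i))
  refine {zero} c b b-idem b≢0 = b , b-idem , b≢0 , ≼-refl , λ ()
  refine {suc l} c b b-idem b≢0 with ≟ₐ (b · (c zero · c zero)) 0#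
  ... | yes bc≡0 with refine (c ∘ suc) b b-idem b≢0
  ...   | e , e-idem , e≢0 , e≤b , splits = e , e-idem , e≢0 , e≤b ,
    λ { zero → inj₂ (≼0#⇒≡ (≼-trans (·-monoˡ _ e≤b) (≼-reflexive bc≡0))) ; (suc i) → splits i }
  refine {suc l} c b b-idem b≢0 | no bc≢0
    with refine (c ∘ suc) (b · (c zero · c zero))
           (subst (λ w → (w · c²) · (w · c²) ≡ w · c²) b-idem (squares-idem b (c zero))) bc≢0
    where c² = c zero · c zero
  ... | e , e-idem , e≢0 , e≤bc , splits = e , e-idem , e≢0 , ≼-trans e≤bc (·-lower₁ _ _) ,
    λ { zero → inj₁ (≼-antisym (·-lower₁ _ _)
          (≼-trans (≼-reflexive (sym e-idem)) (·-monoʳ e (≼-trans e≤bc (·-lower₂ _ _)))))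
      ; (suc i) → splits i }

  atom-below : ∀ b → b · b ≡ b → b ≢ 0# → ∃ λ e → Atom e × (e ≼ b)
  atom-below b b-idem b≢0 with refine enum.from b b-idem b≢0
  ... | e , e-idem , e≢0 , e≤b , splits = e , atom e-idem e≢0 (∀-enum splits) , e≤b

  atoms-equal-or-disjoint : ∀ {e e'} → Atom e → Atom e' → e ≡ e' ⊎ e · e' ≡ 0#
  atoms-equal-or-disjoint {e} {e'} (atom p _ s) (atom p' _ s') with s e' | s' e
  ... | inj₂ q | _ = inj₂ (trans (cong (e ·_) (sym p')) q)
  ... | inj₁ _ | inj₂ q = inj₂ (trans (M.⊙-comm e e') (trans (cong (e' ·_) (sym p)) q))
  ... | inj₁ q | inj₁ q' = inj₁ (trans (sym q) (trans (cong (e ·_) p')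
          (trans (M.⊙-comm e e') (trans (cong (e' ·_) (sym p)) q'))))

  -- The order of the quotient of A by the filter generated by e.
  _≤[_]_ : X → X → X → Set
  x ≤[ e ] y = (e · x) ≼ y

  module AtomChain {e} (e-atom : Atom e) where
    open Atom e-atom

    R : X → X → Set
    R x y = x ≤[ e ] y

    ≼⇒R : ∀ {x y} → x ≼ y → R x y
    ≼⇒R p = ≼-trans (·-lower₂ e _) p

    R-trans : ∀ {x y z} → R x y → R y z → R x z
    R-trans {x} {y} {z} p q = ≼-trans (≼-reflexive eq) (≼-trans (·-monoʳ e p) q)
      where
      eq : e · x ≡ e · (e · x)
      eq = trans (cong (_· x) (sym e-idem)) (M.⊙-assoc e e x)

    square-absorbs⇒≼ : ∀ {c} → e · (c · c) ≡ e → e ≼ c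
    square-absorbs⇒≼ {c} p = ≼-trans (≼-reflexive (sym p)) (≼-trans (·-lower₂ e _) (·-lower₁ c c))

    ⋠⇒square-disjoint : ∀ {c} → ¬ e ≼ c → e · (c · c) ≡ 0#
    ⋠⇒square-disjoint {c} e≰c with e-splits c
    ... | inj₂ p = p
    ... | inj₁ p = ⊥-elim (e≰c (square-absorbs⇒≼ p))

    R-total : ∀ x y → R x y ⊎ R y x
    R-total x y with e-splits (x ↝ y) | e-splits (y ↝ x)
    ... | inj₁ p | _ = inj₁ (M.res← e x y (square-absorbs⇒≼ p))
    ... | inj₂ _ | inj₁ p = inj₂ (M.res← e y x (square-absorbs⇒≼ p))
    ... | inj₂ p | inj₂ q = ⊥-elim (e≢0 (trans (sym (splits e x y)) (trans (cong₂ _⊔_ p q) (≼⇒⊔ ≼-refl))))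

    R-⊓ : ∀ {x y} → R x y → R x (x ⊓ y)
    R-⊓ p = ⊓-glb (·-lower₂ e _) p

    R-⊔ : ∀ {x y} → R x y → R (x ⊔ y) y
    R-⊔ {x} {y} p = ≼-trans (≼-reflexive (M.⊙-comm e (x ⊔ y)))
      (M.res← (x ⊔ y) e y (⊔-lub (M.res→ x e y (≼-trans (≼-reflexive (M.⊙-comm x e)) p))
                                 (M.res→ y e y (·-lower₁ y e))))

    R1⇒≼ : ∀ {x} → R 1# x → e ≼ x
    R1⇒≼ p = ≼-trans (≼-reflexive (sym (M.⊙-unit e))) p

    R-·-unit : ∀ {x y} → R 1# x → R y (x · y)
    R-·-unit p = ·-monoˡ _ (R1⇒≼ p)

    -- Modulo `e` the product `x · y` is at most `y · y`, and this square is `0` because `e` splits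
    -- it and is not below `y`.
    ¬R1-· : ∀ {x y} → R x y → ¬ R 1# y → R (x · y) 0#
    ¬R1-· {x} {y} x≤y ¬1≤y = subst (R (x · y)) (⋠⇒square-disjoint λ e≤y → ¬1≤y (≼-trans (·-lower₁ e 1#) e≤y))
      (≼-trans (≼-reflexive eq) (·-monoʳ e (·-monoˡ y x≤y)))
      where
      eq : e · (x · y) ≡ e · ((e · x) · y)
      eq = trans (cong (_· (x · y)) (sym e-idem))
             (trans (M.⊙-assoc e e (x · y)) (cong (e ·_) (sym (M.⊙-assoc e x y))))

    drastic-R : ∀ x y → ¬ R 1# x → ¬ R 1# y → R (x · y) 0#
    drastic-R x y ¬1≤x ¬1≤y with R-total x y
    ... | inj₁ x≤y = ¬R1-· x≤y ¬1≤y
    ... | inj₂ y≤x = subst (λ w → R w 0#) (M.⊙-comm y x) (¬R1-· y≤x ¬1≤x)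

    R-↝-intro : ∀ {x y z} → R (z · x) y → R z (x ↝ y)
    R-↝-intro {x} {y} {z} p = M.res→ (e · z) x y (≼-trans (≼-reflexive (M.⊙-assoc e z x)) p)

    R-↝-elim : ∀ {x y z} → R z (x ↝ y) → R (z · x) y
    R-↝-elim {x} {y} {z} p = ≼-trans (≼-reflexive (sym (M.⊙-assoc e z x))) (M.res← (e · z) x y p)

    ¬R10 : ¬ R 1# 0#
    ¬R10 p = e≢0 (≼0#⇒≡ (R1⇒≼ p))

    -- Only the specification of the ranking is used below, so its computation is kept from
    -- unfolding. As `e` is not `0`, the quotient separates `0` from `1` and has the two elements
    -- that `drasticChain` requires.
    abstract
      ranking : Σ ℕ λ m → Ranking R (suc (suc m))
      ranking = two-ranks ¬R10 (_ , ranking-pullback (proj₂ (finite A)) (proj₂ (rank-Fin {R = R}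
        (≼⇒R ≼-refl) R-trans R-total (λ x y → ≟ₐ ((e · x) ⊓ y) (e · x)) enum.from)))

    height : ℕ
    height = proj₁ ranking

    open Ranking (proj₂ ranking) public
    private
      module D = DrasticChain height

      rank-cong : ∀ {x y} → R x y → R y x → rank x ≡ rank y
      rank-cong p q = Fin.≤-antisym (rank-mono p) (rank-mono q)

      rank-0 : rank 0# ≡ zero
      rank-0 = Fin.≤-antisym (subst (rank 0# ≤F_) (rank-rep zero) (rank-mono (≼⇒R 0#-min))) z≤n

      rank-1 : rank 1# ≡ D.topD
      rank-1 = fromℕ≤⇒≡ (subst (_≤F rank 1#) (rank-rep D.topD) (rank-mono (≼⇒R 1#-max)))

      rank≡top⇒R1 : ∀ {x} → rank x ≡ D.topD → R 1# x
      rank≡top⇒R1 p = rank-cancel (Fin.≤-reflexive (trans rank-1 (sym p)))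

      R1⇒rank≡top : ∀ {x} → R 1# x → rank x ≡ D.topD
      R1⇒rank≡top p = trans (rank-cong (≼⇒R 1#-max) p) rank-1

      rank-∧ : ∀ x y → rank (x ⊓ y) ≡ _∧_ D.drasticChain (rank x) (rank y)
      rank-∧ x y with R-total x y
      ... | inj₁ p = trans (rank-cong (≼⇒R (⊓-lower₁ x y)) (R-⊓ p)) (sym (D.≤⇒⊓ (rank-mono p)))
      ... | inj₂ p = trans (rank-cong (≼⇒R (⊓-lower₂ x y)) (subst (R y) (M.∧-comm y x) (R-⊓ p)))
                       (sym (trans (∧-comm D.drasticChain (rank x) (rank y)) (D.≤⇒⊓ (rank-mono p))))

      rank-∨ : ∀ x y → rank (x ⊔ y) ≡ _∨_ D.drasticChain (rank x) (rank y)
      rank-∨ x y with R-total x y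
      ... | inj₁ p = trans (rank-cong (R-⊔ p) (≼⇒R (⊔-upper₂ x y))) (sym (D.≤⇒⊔ (rank-mono p)))
      ... | inj₂ p = trans (rank-cong (subst (λ w → R w x) (M.∨-comm y x) (R-⊔ p)) (≼⇒R (M.∧-absorb x y)))
                       (sym (trans (∨-comm D.drasticChain (rank x) (rank y)) (D.≤⇒⊔ (rank-mono p))))

      rank-· : ∀ x y → Dec (rank x ≡ D.topD) → Dec (rank y ≡ D.topD) → rank (x · y) ≡ D.mul (rank x) (rank y)
      rank-· x y (yes p) _ = trans (rank-cong (≼⇒R (·-lower₂ x y)) (R-·-unit (rank≡top⇒R1 p)))
        (sym (trans (cong (λ w → D.mul w (rank y)) p) (D.mul-topˡ (rank y))))
      rank-· x y (no _) (yes p) =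
        trans (rank-cong (≼⇒R (·-lower₁ x y)) (subst (R x) (M.⊙-comm y x) (R-·-unit (rank≡top⇒R1 p))))
          (sym (trans (cong (D.mul (rank x)) p) (D.mul-topʳ (rank x))))
      rank-· x y (no p) (no q) =
        trans (rank-cong (drastic-R x y (p ∘ R1⇒rank≡top) (q ∘ R1⇒rank≡top)) (≼⇒R 0#-min))
          (trans rank-0 (sym (D.mul-drastic p q)))

      rank-↝ : ∀ x y → Dec (rank x ≤F rank y) → Dec (rank x ≡ D.topD) → rank (x ↝ y) ≡ D.imp (rank x) (rank y)
      rank-↝ x y (yes p) _ =
        trans (rank-cong (≼⇒R 1#-max) (R-↝-intro (subst (λ w → R w y) (sym (1#-unitˡ x)) (rank-cancel p))))
          (trans rank-1 (sym (D.imp-≤ p)))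
      rank-↝ x y (no _) (yes p) =
        trans (rank-cong (R-trans (R-·-unit (rank≡top⇒R1 p)) (≼⇒R (modus-ponens x y))) (R-↝-intro (≼⇒R (·-lower₁ y x))))
          (sym (trans (cong (λ w → D.imp w (rank y)) p) (D.imp-topˡ (rank y))))
      rank-↝ x y (no x≰y) (no x≢top) = trans (Fin.≤-antisym (D.≤coatom imp≢top) coatom≤imp)
          (sym (D.imp-coatom x≰y x≢top))
        where
        imp≢top : rank (x ↝ y) ≢ D.topD
        imp≢top p = x≰y (rank-mono (subst (λ w → R w y) (1#-unitˡ x) (R-↝-elim (rank≡top⇒R1 p))))
        -- A witness that the residual reaches the coatom: neither `z` nor `x` is `1` modulo `e`, so
        -- `z · x` vanishes there and `z` is below `x ↝ y`.
        z = rep D.coatom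
        z≢top : ¬ R 1# z
        z≢top p = D.≤coatom⇒≢ Fin.≤-refl (trans (sym (rank-rep D.coatom)) (R1⇒rank≡top p))
        coatom≤imp : D.coatom ≤F rank (x ↝ y)
        coatom≤imp = subst (_≤F rank (x ↝ y)) (rank-rep D.coatom)
          (rank-mono (R-↝-intro (R-trans (drastic-R z x z≢top (x≢top ∘ R1⇒rank≡top)) (≼⇒R 0#-min))))

    rank-hom : MTLHom (alg A) (drasticChain height)
    rank-hom = record
      { fun = rank
      ; h∧ = rank-∧
      ; h∨ = rank-∨
      ; h⊙ = λ x y → rank-· x y (rank x Fin.≟ D.topD) (rank y Fin.≟ D.topD)
      ; h⇒ = λ x y → rank-↝ x y (rank x Fin.≤? rank y) (rank x Fin.≟ D.topD)
      ; h𝟘 = rank-0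
      ; h𝟙 = rank-1 }

  -- Let `c = x ↝ y`. If the complement of `c · c` is `0`, then `c` is `1`. Otherwise some atom lies
  -- below the complement; by hypothesis it is also below `c`, hence below `c · c`, and so it is
  -- `0`.
  ≼-by-atoms : ∀ {x y} → (∀ e → Atom e → x ≤[ e ] y) → x ≼ y
  ≼-by-atoms {x} {y} p with ≟ₐ (((x ↝ y) · (x ↝ y)) ↝ 0#) 0#
  ... | yes q = ↝≡1#⇒≼ (1#≼⇒≡ (≼-trans (≼-reflexive (sym c²≡1)) (·-lower₁ c c)))
    where
    c = x ↝ y
    c²≡1 : c · c ≡ 1#
    c²≡1 = trans (sym (trans (M.∨-comm _ _) (≼⇒⊔ 0#-min)))
      (trans (cong ((c · c) ⊔_) (sym q)) (square-complement c))
  ... | no q with atom-below _ (complement-idem (x ↝ y)) q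
  ...   | e , e-atom@(atom e-idem e≢0 _) , e≤¬c² = ⊥-elim (e≢0 (≼0#⇒≡ (≼-trans (≼-reflexive (sym e-idem))
          (≼-trans (·-monoˡ e e≤c²) (≼-trans (·-monoʳ (c · c) e≤¬c²) (modus-ponens (c · c) 0#))))))
    where
    c = x ↝ y
    e≤c : e ≼ c
    e≤c = M.res→ e x y (p e e-atom)
    e≤c² : e ≼ (c · c)
    e≤c² = ≼-trans (≼-reflexive (sym e-idem)) (≼-trans (·-monoˡ e e≤c) (·-monoʳ c e≤c))

  abstract
    atoms : Enumeration (Atom ∘ enum.from)
    atoms = enumerate (atom? ∘ enum.from)
  open Enumeration atoms

  atomAt : Fin count → X
  atomAt = enum.from ∘ item

  module At i = AtomChain {atomAt i} (item-sat i)

  spectrum : MCObj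
  spectrum = record { n = count ; len = At.height }

  represent : MTLHom (alg A) (alg (dual₀ spectrum))
  represent = tuple (Chains spectrum) At.rank-hom

  represent-injective : ∀ {x y} → fun represent x ≡ fun represent y → x ≡ y
  represent-injective {x} {y} p = ≼-antisym (≼-by-atoms (below p)) (≼-by-atoms (below (sym p)))
    where
    below : ∀ {x y} → fun represent x ≡ fun represent y → ∀ e → Atom e → x ≤[ e ] y
    below {x} {y} p e e-atom with item-surj (enum.to e) (subst Atom (sym (enum.strictlyInverseʳ e)) e-atom)
    ... | i , q = subst (λ w → x ≤[ w ] y) (trans (cong enum.from q) (enum.strictlyInverseʳ e))
      (At.rank-cancel i (Fin.≤-reflexive
        (trans (sym (π-tuple (Chains spectrum) At.rank-hom i x))
          (trans (cong (fun (π (Chains spectrum) i)) p) (π-tuple (Chains spectrum) At.rank-hom i y)))))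

  ⋁ : ∀ {l} → (Fin l → X) → X
  ⋁ {zero} u = 0#
  ⋁ {suc l} u = u zero ⊔ ⋁ (u ∘ suc)

  ⋁-upper : ∀ {l} (u : Fin l → X) i → u i ≼ ⋁ u
  ⋁-upper u zero = M.∧-absorb _ _
  ⋁-upper u (suc i) = ≼-trans (⋁-upper (u ∘ suc) i) (⊔-upper₂ _ _)

  ⋁-lub : ∀ {l} (u : Fin l → X) {z} → (∀ i → u i ≼ z) → ⋁ u ≼ z
  ⋁-lub {zero} u p = 0#-min
  ⋁-lub {suc l} u p = ⊔-lub (p zero) (⋁-lub (u ∘ suc) (p ∘ suc))

  -- Each representative is cut down to its own atom. Distinct atoms are disjoint, so modulo
  -- `atomAt i` only the summand at `i` survives.
  glue : Carrier (alg (dual₀ spectrum)) → X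
  glue t = ⋁ λ j → atomAt j · At.rep j (fun (π (Chains spectrum) j) t)

  represent-glue : ∀ t → fun represent (glue t) ≡ t
  represent-glue t = ∏-ext (Chains spectrum) λ i → trans (π-tuple (Chains spectrum) At.rank-hom i (glue t))
    (trans (Fin.≤-antisym (At.rank-mono i (glued≤ i)) (At.rank-mono i (⋁-upper _ i))) (At.rank-rep i _))
    where
    a : Fin count → X
    a j = At.rep j (fun (π (Chains spectrum) j) t)
    summand : ∀ i j → Dec (j ≡ i) → ((atomAt j · a j) · atomAt i) ≼ a i
    summand i j (yes refl) = ≼-trans (·-lower₁ _ _) (·-lower₂ _ _)
    summand i j (no j≢i) with atoms-equal-or-disjoint (item-sat i) (item-sat j)
    ... | inj₁ p = ⊥-elim (j≢i (item-inj (trans (sym (enum.strictlyInverseˡ _))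
                     (trans (cong enum.to (sym p)) (enum.strictlyInverseˡ _)))))
    ... | inj₂ p = ≼-trans (≼-reflexive (M.⊙-comm _ _)) (≼-trans (·-monoʳ _ (·-lower₁ _ _))
                     (≼-trans (≼-reflexive p) 0#-min))
    glued≤ : ∀ i → glue t ≤[ atomAt i ] a i
    -- Residuation moves the factor `atomAt i` to the right-hand side, where the join can be bounded
    -- summand by summand.
    glued≤ i = ≼-trans (≼-reflexive (M.⊙-comm _ _)) (M.res← _ _ _
      (⋁-lub (λ j → atomAt j · a j) λ j → M.res→ _ _ _ (summand i j (j Fin.≟ i))))

  dual-spectrum : Iso (op DPfin) (dual₀ spectrum) A
  dual-spectrum = record
    -- Arrows of `op DPfin` are reversed: the forward map is a homomorphism out of `A`, and `left`
    -- concerns `represent` after `glue`.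
    { fwd = represent
    ; bwd = inverse-hom represent represent-injective glue represent-glue
    ; left = represent-glue
    ; right = λ x → represent-injective (represent-glue (fun represent x)) }

MCT≃DPfinᵒᵖ : DualEquivalence MCT DPfin
MCT≃DPfinᵒᵖ = ff+split-eso⇒equivalence DPfin-isCategory dualFunctor dualFunctor-ff
  Decomposition.spectrum Decomposition.dual-spectrum

theorem18 : Equivalence MCT HF𝟏 × DualEquivalence MCT DPfin
theorem18 = MCT≃HF𝟏 , MCT≃DPfinᵒᵖ
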